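{- The classes $\mathtt{HCEGIS}$ and $\mathtt{CEGIS}$ are incomparable: $\mathtt{HCEGIS}\not\subseteq\mathtt{CEGIS}$ and $\mathtt{CEGIS}\not\subseteq\mathtt{HCEGIS}$ (in particular $\mathtt{HCEGIS}\neq\mathtt{CEGIS}$). Here $\mathtt{CEGIS}$ (resp. $\mathtt{HCEGIS}$) denotes the class of indexed families of languages $\mathscr{L}$ for which there exists a CEGIS engine (resp. HCEGIS engine) that identifies $\mathscr{L}$.
   Context: Languages are subsets of $\mathbb{N}$, ordered by the natural order of $\mathbb{N}$; $\overline{L}=\mathbb{N}\setminus L$. An indexed family of languages is a sequence $\mathscr{L}=L_0,L_1,\ldots$ of non-empty recursive languages for which there is a total recursive function $\mathtt{TEMPLATE}$ with $\mathtt{TEMPLATE}(i,n)=1$ if $n\in L_i$ and $0$ otherwise; the program $P_i$ is $n\mapsto\mathtt{TEMPLATE}(i,n)$, $\mathscr{P}=\{P_0,P_1,\ldots\}$, and $L(P_i)=L_i$. A sequence is a map $\sigma:\mathbb{N}\to\mathbb{N}\cup\{\bot\}$; $\sigma[k]$ is its prefix of length $k$, $\sigma(k)$ its $k$-th element, $\sigma_0$ the empty sequence, $\mathtt{SMPL}(\sigma)=\mathrm{range}(\sigma)\setminus\{\bot\}$. A trace for $L$ is a sequence $\tau$ with $\mathtt{SMPL}(\tau)=L$. A verifier $\mathtt{CHECK}_L$ is a (non-deterministic) map from $\mathscr{L}$ to $\mathbb{N}\cup\{\bot\}$ with $\mathtt{CHECK}_L(L_i)=\bot$ iff $L_i\subseteq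 L$ and otherwise $\mathtt{CHECK}_L(L_i)\in L_i\cap\overline{L}$. A history-bounded verifier $\mathtt{HCHECK}_L$ maps a language $L_i\in\mathscr{L}$ and a trace prefix $\tau[n]$ to $\mathbb{N}\cup\{\bot\}$: $\mathtt{HCHECK}_L(L_i,\tau[n])=m$ for some $m\in\overline{L}\cap L_i$ with $m<\tau(j)$ for some $j\le n$, if such $m$ exists, and $\mathtt{HCHECK}_L(L_i,\tau[n])=\bot$ otherwise. A CEGIS engine is given by a recursive $F:\mathscr{P}\times\mathbb{N}\times\mathbb{N}\to\mathscr{P}$ (counterexample argument may be $\bot$) and initial program $P_0$: $T(\sigma_0,\sigma_0)=P_0$, $T(\tau[n],\mathtt{cex}[n])=F(T(\tau[n-1],\mathtt{cex}[n-1]),\tau(n),\mathtt{cex}(n))$, where $\tau$ is a trace of the target language $L$ and $\mathtt{cex}(i)=\mathtt{CHECK}_L(L(T(\tau[i-1],\mathtt{cex}[i-1])))$. An HCEGIS engine is defined identically but with $\mathtt{cex}(i)=\mathtt{HCHECK}_L(L(T(\tau[i-1],\mathtt{cex}[i-1])),\tau[i-1])$. $T$ converges to $P_i$ on $(\tau,\mathtt{cex})$ if $T(\tau[n],\mathtt{cex}[n])=P_i$ for all sufficiently large $n$; $T$ identifies $L_i$ if it converges to $P_i$ for every trace $\tau$ of $L_i$ and every corresponding counterexample sequence; $T$ identifies $\mathscr{L}$ if it identifies every member. -}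

module Defs where

open import Data.Fin.Base using (Fin)
open import Data.Maybe.Base using (Maybe; just; nothing)
open import Data.Nat.Base using (ℕ; zero; suc; _≤_; _<_)
open import Data.Product.Base using (Σ-syntax; ∃-syntax; _×_)
open import Data.Sum.Base using (_⊎_)
open import Data.Vec.Base using (Vec; []; _∷_; lookup)
open import Data.Vec.Relation.Binary.Pointwise.Inductive using (Pointwise)
open import Level using (0ℓ)
open import Relation.Binary.PropositionalEquality.Core using (_≡_)
open import Relation.Nullary.Negation.Core using (¬_)
open import Relation.Unary using (Pred; _∈_; _∩_; _⊆_; _≐_; ∁)

data Code : ℕ → Set where
  zeroᶜ : Code 0
  sucᶜ  : Code 1
  proj  : ∀ {n} → Fin n → Code n
  comp  : ∀ {m n} → Code m → Vec (Code n) m → Code n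
  prec  : ∀ {n} → Code n → Code (suc (suc n)) → Code (suc n)
  μ     : ∀ {n} → Code (suc n) → Code n

infix 4 _[_]⇓_

data _[_]⇓_ : ∀ {n} → Code n → Vec ℕ n → ℕ → Set where
  ⇓-zero  : zeroᶜ [ [] ]⇓ 0
  ⇓-suc   : ∀ {x} → sucᶜ [ x ∷ [] ]⇓ suc x
  ⇓-proj  : ∀ {n} (i : Fin n) {xs} → proj i [ xs ]⇓ lookup xs i
  ⇓-comp  : ∀ {m n} {f : Code m} {gs : Vec (Code n) m} {xs ys z} →
            Pointwise (λ g y → g [ xs ]⇓ y) gs ys → f [ ys ]⇓ z →
            comp f gs [ xs ]⇓ z
  ⇓-prec₀ : ∀ {n} {f : Code n} {g xs z} →
            f [ xs ]⇓ z → prec f g [ 0 ∷ xs ]⇓ z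
  ⇓-precₛ : ∀ {n} {f : Code n} {g k xs y z} →
            prec f g [ k ∷ xs ]⇓ y → g [ k ∷ y ∷ xs ]⇓ z →
            prec f g [ suc k ∷ xs ]⇓ z
  ⇓-μ     : ∀ {n} {f : Code (suc n)} {xs z} →
            (∀ k → k < z → ∃[ y ] (f [ k ∷ xs ]⇓ suc y)) →
            f [ z ∷ xs ]⇓ 0 →
            μ f [ xs ]⇓ z

Recursive : ∀ {n} → (Vec ℕ n → ℕ) → Set
Recursive {n} f = Σ[ c ∈ Code n ] (∀ xs → c [ xs ]⇓ f xs)

-- ℕ ∪ {⊥} is Maybe ℕ; a recursive function receives ⊥ as 0 and n as n + 1.
decode : ℕ → Maybe ℕ
decode zero    = nothing
decode (suc n) = just n

Language : Set₁
Language = Pred ℕ 0ℓ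

record IndexedFamily : Set where
  field
    template  : ℕ → ℕ → ℕ
    binary    : ∀ i n → template i n ≡ 0 ⊎ template i n ≡ 1
    recursive : Recursive {2} λ { (i ∷ n ∷ []) → template i n }
    nonEmpty  : ∀ i → ∃[ n ] template i n ≡ 1

  lang : ℕ → Language
  lang i n = template i n ≡ 1

  -- The index i stands for the program P_i = template i.  Programs are equal
  -- when they are equal as functions, so an index may be traded for any other
  -- index of the same program.
  infix 4 _≈ᴾ_
  _≈ᴾ_ : ℕ → ℕ → Set
  i ≈ᴾ j = ∀ n → template i n ≡ template j n

-- The k-th element of a sequence, counted from 1, is its value at k - 1; the
-- prefix of length n consists of the values at 0, …, n - 1.
Sequence : Set
Sequence = ℕ → Maybe ℕ

SMPL : Sequence → Language
SMPL σ n = ∃[ k ] σ k ≡ just n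

IsTrace : Language → Sequence → Set
IsTrace L τ = SMPL τ ≐ L

-- Verifiers are non-deterministic, hence given by the relation between
-- a query and its admissible answers: the target L, the conjectured language K,
-- the trace τ, the length n of the prefix seen so far, and the answer.
Verifier : Set₁
Verifier = Language → Language → Sequence → ℕ → Maybe ℕ → Set

CHECK : Verifier
CHECK L K τ n nothing  = K ⊆ L
CHECK L K τ n (just m) = m ∈ K ∩ ∁ L

BelowHistory : Sequence → ℕ → Language
BelowHistory τ n m = ∃[ j ] j < n × ∃[ v ] τ j ≡ just v × m < v

HCHECK : Verifier
HCHECK L K τ n nothing  = ¬ (∃[ m ] m ∈ ∁ L ∩ K ∩ BelowHistory τ n)
HCHECK L K τ n (just m) = m ∈ ∁ L ∩ K ∩ BelowHistory τ n

record Engine (𝓛 : IndexedFamily) : Set where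
  open IndexedFamily 𝓛 using (_≈ᴾ_)
  field
    F           : ℕ → Maybe ℕ → Maybe ℕ → ℕ
    F-cong      : ∀ {i j} x c → i ≈ᴾ j → F i x c ≈ᴾ F j x c
    F-recursive : Recursive {3} λ { (i ∷ x ∷ c ∷ []) → F i (decode x) (decode c) }
    initial     : ℕ

  -- T τ cex n is (an index of) T(τ[n], cex[n]).
  T : Sequence → Sequence → ℕ → ℕ
  T τ cex zero    = initial
  T τ cex (suc n) = F (T τ cex n) (τ n) (cex n)

module _ (V : Verifier) {𝓛 : IndexedFamily} (E : Engine 𝓛) where
  open IndexedFamily 𝓛
  open Engine E

  IsCexSequence : Language → Sequence → Sequence → Set
  IsCexSequence L τ cex = ∀ n → V L (lang (T τ cex n)) τ n (cex n)

  ConvergesTo : ℕ → Sequence → Sequence → Set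
  ConvergesTo i τ cex = ∃[ N ] ∀ n → N ≤ n → T τ cex n ≈ᴾ i

  IdentifiesMember : ℕ → Set
  IdentifiesMember i = ∀ τ cex → IsTrace (lang i) τ →
                       IsCexSequence (lang i) τ cex → ConvergesTo i τ cex

  Identifies : Set
  Identifies = ∀ i → IdentifiesMember i

CEGIS : Pred IndexedFamily 0ℓ
CEGIS 𝓛 = Σ[ E ∈ Engine 𝓛 ] Identifies CHECK E

HCEGIS : Pred IndexedFamily 0ℓ
HCEGIS 𝓛 = Σ[ E ∈ Engine 𝓛 ] Identifies HCHECK E

{-# OPTIONS --safe #-}

-- CEGIS ⊈ HCEGIS: ℕ together with its finite initial segments.  The first query
-- "is ℕ contained in the target?" separates ℕ from the segments, and a segment is
-- found as the maximum of the data.  In a segment everything below a datum is a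
-- member, so a history-bounded verifier never answers, and Gold's argument applies.
--
-- HCEGIS ⊈ CEGIS: the engine's only memory is its current hypothesis, and it must
-- visit a language S p at some point of every trace of S p.
--   * With unrestricted counterexamples such a visit costs everything seen before:
--     all wrong hypotheses can be refuted by junk members, so the adversary always
--     shows a fresh datum d just before the visit, and afterwards the engine cannot
--     tell a target R t from R t with d added.
--   * With history-bounded counterexamples the junk of the probes G b k lies above
--     the history as soon as b is large.  The verifier's answers to probes then tell
--     how large the data have been and whether they exhaust S p below that bound, so
--     nothing has to be remembered.
module Submission where

open import Defs
open import Data.Bool.Base using (Bool; true; false; not; _∧_; _∨_; if_then_else_)
open import Data.Bool.Properties using (T-≡) renaming (_≟_ to _≟ᵇ_)
open import Data.Empty using (⊥; ⊥-elim)
open import Data.Fin.Base using (Fin; suc)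
open import Data.Fin.Patterns using (0F; 1F; 2F; 3F; 4F)
open import Data.List.Base using (List; []; _∷_; _++_; length; replicate)
open import Data.List.Properties using (length-++; length-replicate)
open import Data.Maybe.Base using (Maybe; just; nothing)
open import Data.Maybe.Properties using (just-injective; ≡-dec)
open import Data.Nat.Base
open import Data.Nat.Induction using (<-rec)
open import Data.Nat.Properties
open import Data.Product.Base using (_×_; _,_; proj₁; proj₂; ∃-syntax)
open import Data.Sum.Base using (_⊎_; inj₁; inj₂)
open import Data.Vec.Base using (Vec; []; _∷_; lookup)
open import Data.Vec.Relation.Binary.Pointwise.Inductive using (Pointwise; []; _∷_)
open import Function.Base using (_∘_)
open import Function.Bundles using (Equivalence)
open import Relation.Binary.Definitions using (tri<; tri≈; tri>)
open import Relation.Binary.PropositionalEquality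
open import Relation.Nullary.Decidable.Core using (Dec; yes; no)
open import Relation.Nullary.Negation.Core using (¬_)
open import Relation.Unary using (_⊈_; _≐_)

-- Recursive functions

-- In the adversary argument one run has to be legal for several targets at once: what precedes the
-- visit to `S p` is answered as for the target `S p`, and must also be correct for `R t` and for
-- `R t` with `d` added. This shapes the languages `R u`. As a hypothesis each is refuted by an odd
-- `ord` or by `two 0`, neither of which is in any `S p`; a target `R t` of the adversary has
-- exactly one odd `ord`, its label, and hence does not contain `two 0`. So the old answers remain
-- correct as long as the label is not among them. One answer may depend on `d`, which is chosen
-- after the label; therefore two labels are kept ready. There are two languages `S p` because the
-- engine may start at one of them, before any datum. For the history-bounded engine sizes matter.
-- The junk of `G b k` has a value between `b * 6` and `b * 6 + 6`, so it rises with `b` past a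
-- fixed history; the infinitely many `zed` let the history rise past any fixed error of a
-- hypothesis when the target is some `R t`.

Recursive-cong : ∀ {n} {f g : Vec ℕ n → ℕ} → (∀ xs → f xs ≡ g xs) → Recursive f → Recursive g
Recursive-cong f≗g (c , c⇓f) = c , λ xs → subst (c [ xs ]⇓_) (f≗g xs) (c⇓f xs)

-- Expressions over functions already known to be recursive: a function is shown recursive by an
-- expression whose `eval` agrees with it, and the derivations come from `compile-⇓`.
data Exp (n : ℕ) : Set where
  var  : Fin n → Exp n
  call : ∀ {m} {f : Vec ℕ m → ℕ} → Recursive f → Vec (Exp n) m → Exp n

eval  : ∀ {n} → Exp n → Vec ℕ n → ℕ
evals : ∀ {n m} → Vec (Exp n) m → Vec ℕ n → Vec ℕ m
eval (var i)            xs = lookup xs i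
eval (call {f = f} _ es) xs = f (evals es xs)
evals []       xs = []
evals (e ∷ es) xs = eval e xs ∷ evals es xs

compile  : ∀ {n} → Exp n → Code n
compiles : ∀ {n m} → Vec (Exp n) m → Vec (Code n) m
compile (var i)          = proj i
compile (call (c , _) es) = comp c (compiles es)
compiles []       = []
compiles (e ∷ es) = compile e ∷ compiles es

compile-⇓  : ∀ {n} (e : Exp n) xs → compile e [ xs ]⇓ eval e xs
compiles-⇓ : ∀ {n m} (es : Vec (Exp n) m) xs →
             Pointwise (λ c y → c [ xs ]⇓ y) (compiles es) (evals es xs)
compile-⇓ (var i)           xs = ⇓-proj i
compile-⇓ (call (_ , c⇓) es) xs = ⇓-comp (compiles-⇓ es xs) (c⇓ _)
compiles-⇓ []       xs = []
compiles-⇓ (e ∷ es) xs = compile-⇓ e xs ∷ compiles-⇓ es xs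

exp-recursive : ∀ {n} (e : Exp n) → Recursive (eval e)
exp-recursive e = compile e , compile-⇓ e

prec-recursive : ∀ {n} {g : Vec ℕ (suc n) → ℕ} (e₀ : Exp n) (e₁ : Exp (2 + n)) →
                 (∀ xs → eval e₀ xs ≡ g (0 ∷ xs)) →
                 (∀ k xs → eval e₁ (k ∷ g (k ∷ xs) ∷ xs) ≡ g (suc k ∷ xs)) →
                 Recursive g
prec-recursive {g = g} e₀ e₁ g-zero g-suc = prec (compile e₀) (compile e₁) , λ { (k ∷ xs) → go k xs }
  where
  go : ∀ k xs → prec (compile e₀) (compile e₁) [ k ∷ xs ]⇓ g (k ∷ xs)
  go zero    xs = ⇓-prec₀ (subst (compile e₀ [ xs ]⇓_) (g-zero xs) (compile-⇓ e₀ xs))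
  go (suc k) xs = ⇓-precₛ (go k xs) (subst (compile e₁ [ k ∷ g (k ∷ xs) ∷ xs ]⇓_) (g-suc k xs) (compile-⇓ e₁ _))

fun₁ : (ℕ → ℕ) → Vec ℕ 1 → ℕ
fun₁ f (a ∷ []) = f a

fun₂ : (ℕ → ℕ → ℕ) → Vec ℕ 2 → ℕ
fun₂ f (a ∷ b ∷ []) = f a b

fun₃ : (ℕ → ℕ → ℕ → ℕ) → Vec ℕ 3 → ℕ
fun₃ f (a ∷ b ∷ c ∷ []) = f a b c

call₁ : ∀ {n f} → Recursive (fun₁ f) → Exp n → Exp n
call₁ r a = call r (a ∷ [])

call₂ : ∀ {n f} → Recursive (fun₂ f) → Exp n → Exp n → Exp n
call₂ r a b = call r (a ∷ b ∷ [])

call₃ : ∀ {n f} → Recursive (fun₃ f) → Exp n → Exp n → Exp n → Exp n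
call₃ r a b c = call r (a ∷ b ∷ c ∷ [])

by-exp₂ : ∀ {f} (e : Exp 2) → (∀ a b → eval e (a ∷ b ∷ []) ≡ f a b) → Recursive (fun₂ f)
by-exp₂ e eq = Recursive-cong (λ { (a ∷ b ∷ []) → eq a b }) (exp-recursive e)

by-prec₁ : ∀ {f : ℕ → ℕ} (e₀ : Exp 0) (e₁ : Exp 2) → eval e₀ [] ≡ f 0 →
           (∀ k → eval e₁ (k ∷ f k ∷ []) ≡ f (suc k)) → Recursive (fun₁ f)
by-prec₁ e₀ e₁ z s = prec-recursive e₀ e₁ (λ { [] → z }) (λ { k [] → s k })

by-prec₂ : ∀ {f : ℕ → ℕ → ℕ} (e₀ : Exp 1) (e₁ : Exp 3) → (∀ a → eval e₀ (a ∷ []) ≡ f 0 a) →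
           (∀ k a → eval e₁ (k ∷ f k a ∷ a ∷ []) ≡ f (suc k) a) → Recursive (fun₂ f)
by-prec₂ e₀ e₁ z s = prec-recursive e₀ e₁ (λ { (a ∷ []) → z a }) (λ { k (a ∷ []) → s k a })

suc-recursive : Recursive (fun₁ suc)
suc-recursive = sucᶜ , λ { (a ∷ []) → ⇓-suc }

zero-recursive : Recursive {0} (λ _ → 0)
zero-recursive = zeroᶜ , λ { [] → ⇓-zero }

sucᵉ : ∀ {n} → Exp n → Exp n
sucᵉ = call₁ suc-recursive

litᵉ : ∀ {n} → ℕ → Exp n
litᵉ zero    = call zero-recursive []
litᵉ (suc k) = sucᵉ (litᵉ k)

+-recursive : Recursive (fun₂ _+_)
+-recursive = by-prec₂ (var 0F) (sucᵉ (var 1F)) (λ _ → refl) (λ _ _ → refl)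

infixl 6 _+ᵉ_ _∸ᵉ_ _⊔ᵉ_
infixl 7 _*ᵉ_

_+ᵉ_ : ∀ {n} → Exp n → Exp n → Exp n
_+ᵉ_ = call₂ +-recursive

*-recursive : Recursive (fun₂ _*_)
*-recursive = by-prec₂ (litᵉ 0) (var 2F +ᵉ var 1F) (λ _ → refl) (λ _ _ → refl)

_*ᵉ_ : ∀ {n} → Exp n → Exp n → Exp n
_*ᵉ_ = call₂ *-recursive

pred-recursive : Recursive (fun₁ pred)
pred-recursive = by-prec₁ (litᵉ 0) (var 0F) refl (λ _ → refl)

-- `prec` recurses on its first argument, subtraction on the number subtracted.
∸-recursive : Recursive (fun₂ _∸_)
∸-recursive = by-exp₂ (call₂ flipped (var 1F) (var 0F)) (λ _ _ → refl)
  where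
  flipped : Recursive (fun₂ (λ b a → a ∸ b))
  flipped = by-prec₂ (var 0F) (call₁ pred-recursive (var 1F)) (λ _ → refl) (λ k a → pred[m∸n]≡m∸[1+n] a k)

_∸ᵉ_ : ∀ {n} → Exp n → Exp n → Exp n
_∸ᵉ_ = call₂ ∸-recursive

ifz : ℕ → ℕ → ℕ → ℕ
ifz zero    a b = a
ifz (suc _) a b = b

ifz-recursive : Recursive (fun₃ ifz)
ifz-recursive = prec-recursive (var 0F) (var 3F) (λ { (_ ∷ _ ∷ []) → refl }) (λ { _ (_ ∷ _ ∷ []) → refl })

ifzᵉ : ∀ {n} → Exp n → Exp n → Exp n → Exp n
ifzᵉ = call₃ ifz-recursive

⊔-recursive : Recursive (fun₂ _⊔_)
⊔-recursive = by-exp₂ (var 0F +ᵉ (var 1F ∸ᵉ var 0F)) (λ a b → sym (m⊔n≡m+n∸m a b))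
  where
  m⊔n≡m+n∸m : ∀ a b → a ⊔ b ≡ a + (b ∸ a)
  m⊔n≡m+n∸m zero    b       = refl
  m⊔n≡m+n∸m (suc a) zero    = cong suc (sym (+-identityʳ a))
  m⊔n≡m+n∸m (suc a) (suc b) = cong suc (m⊔n≡m+n∸m a b)

_⊔ᵉ_ : ∀ {n} → Exp n → Exp n → Exp n
_⊔ᵉ_ = call₂ ⊔-recursive

-- ℕ and its initial segments

encode : Maybe ℕ → ℕ
encode nothing  = 0
encode (just v) = suc v

encode-decode : ∀ x → encode (decode x) ≡ x
encode-decode zero    = refl
encode-decode (suc x) = refl

-- Every number is the code of an element of ℕ ∪ {⊥}, so checking the encoded arguments is enough.
on-codes : ∀ {F : ℕ → Maybe ℕ → Maybe ℕ → ℕ} (e : Exp 3) →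
           (∀ i x c → eval e (i ∷ encode x ∷ encode c ∷ []) ≡ F i x c) →
           ∀ i x c → eval e (i ∷ x ∷ c ∷ []) ≡ F i (decode x) (decode c)
on-codes e eq i x c =
  trans (cong₂ (λ x′ c′ → eval e (i ∷ x′ ∷ c′ ∷ [])) (sym (encode-decode x)) (sym (encode-decode c)))
        (eq i (decode x) (decode c))

module _ {𝓛 : IndexedFamily} (E : Engine 𝓛) where
  open Engine E

  T-prefix : ∀ {τ τ′ c c′} n → (∀ m → m < n → τ m ≡ τ′ m) → (∀ m → m < n → c m ≡ c′ m) →
             T τ c n ≡ T τ′ c′ n
  T-prefix zero    _  _  = refl
  T-prefix {τ} {τ′} {c} {c′} (suc n) τ≗ c≗
    rewrite T-prefix {τ} {τ′} {c} {c′} n (λ m m<n → τ≗ m (m<n⇒m<1+n m<n)) (λ m m<n → c≗ m (m<n⇒m<1+n m<n))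
          | τ≗ n (n<1+n n) | c≗ n (n<1+n n) = refl

module Segments where

  template : ℕ → ℕ → ℕ
  template zero    n = 1
  template (suc j) n = 1 ∸ (n ∸ j)

  member : ∀ {j n} → n ≤ j → template (suc j) n ≡ 1
  member n≤j rewrite m≤n⇒m∸n≡0 n≤j = refl

  bounded : ∀ {j n} → template (suc j) n ≡ 1 → n ≤ j
  bounded {j} {n} p with n ∸ j in eq
  ... | zero  = m∸n≡0⇒m≤n eq
  ... | suc k with () ← trans (sym (0∸n≡0 k)) p

  family : IndexedFamily
  family = record
    { template  = template
    ; binary    = λ { zero n → inj₂ refl ; (suc j) n → binary (n ∸ j) }
    ; recursive = Recursive-cong (λ { (zero ∷ _ ∷ []) → refl ; (suc _ ∷ _ ∷ []) → refl })
        (exp-recursive (ifzᵉ (var 0F) (litᵉ 1) (litᵉ 1 ∸ᵉ (var 1F ∸ᵉ call₁ pred-recursive (var 0F)))))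
    ; nonEmpty  = λ { zero → 0 , refl ; (suc j) → 0 , member {j} z≤n }
    }
    where
    binary : ∀ k → 1 ∸ k ≡ 0 ⊎ 1 ∸ k ≡ 1
    binary zero    = inj₂ refl
    binary (suc k) = inj₁ (0∸n≡0 k)

  open IndexedFamily family using (lang; _≈ᴾ_)

  0≉suc : ∀ {j} → ¬ 0 ≈ᴾ suc j
  0≉suc {j} eq = 1+n≰n (bounded {j} (sym (eq (suc j))))

  ≈⇒≡ : ∀ {i j} → i ≈ᴾ j → i ≡ j
  ≈⇒≡ {zero}  {zero}  _  = refl
  ≈⇒≡ {zero}  {suc j} eq = ⊥-elim (0≉suc {j} eq)
  ≈⇒≡ {suc i} {zero}  eq = ⊥-elim (0≉suc {i} λ n → sym (eq n))
  ≈⇒≡ {suc i} {suc j} eq = cong suc (≤-antisym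
    (bounded {j} (trans (sym (eq i)) (member {i} ≤-refl)))
    (bounded {i} (trans (eq j) (member {j} ≤-refl))))

  down-closed : ∀ i {m v} → m ≤ v → lang i v → lang i m
  down-closed zero    _   _   = refl
  down-closed (suc j) m≤v v∈ = member {j} (≤-trans m≤v (bounded {j} v∈))

  -- The segment with maximum `v` has index `suc v`, which is also `encode (just v)`, so a maximum
  -- of indices tracks the maximum of the data. The 1 takes the engine out of index 0 after a
  -- refutation even if the datum is ⊥; from a positive index it never returns.
  step : ℕ → Maybe ℕ → Maybe ℕ → ℕ
  step i x c = ifz (i + encode c) 0 (i ⊔ 1 ⊔ encode x)

  stepᵉ : Exp 3
  stepᵉ = ifzᵉ (var 0F +ᵉ var 2F) (litᵉ 0) (var 0F ⊔ᵉ litᵉ 1 ⊔ᵉ var 1F)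

  engine : Engine family
  engine = record
    { F           = step
    ; F-cong      = λ {i} {j} x c i≈j n → cong (λ i → template (step i x c) n) (≈⇒≡ {i} {j} i≈j)
    ; F-recursive = Recursive-cong (λ { (i ∷ x ∷ c ∷ []) → on-codes stepᵉ (λ _ _ _ → refl) i x c })
                                   (exp-recursive stepᵉ)
    ; initial     = 0
    }

  open Engine engine using (T)

  identifies : Identifies CHECK engine
  identifies zero τ cex _ ok = 0 , λ n _ v → cong (λ i → template i v) (at-0 n)
    where
    at-0 : ∀ n → T τ cex n ≡ 0
    at-0 zero = refl
    at-0 (suc n) with T τ cex n | at-0 n | cex n | ok n
    ... | _ | refl | nothing | _       = refl
    ... | _ | refl | just m  | _ , m∉ = ⊥-elim (m∉ refl)
  identifies (suc k) τ cex (sound , complete) ok = suc K , λ n K<n v → cong (λ i → template i v) (settled n K<n)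
    where
    K : ℕ
    K = proj₁ (complete (member {k} ≤-refl))

    grows : ∀ n → T τ cex (suc n) ≡ T τ cex n ⊔ 1 ⊔ encode (τ n)
    positive : ∀ n → 1 ≤ T τ cex (suc n)
    grows zero with cex 0 | ok 0
    ... | nothing | ℕ⊆ = ⊥-elim (1+n≰n (bounded {k} (ℕ⊆ {suc k} refl)))
    ... | just m  | _  = refl
    grows (suc n) with T τ cex (suc n) | positive n
    ... | suc i | _ = refl
    positive n rewrite grows n = ≤-trans (m≤n⊔m (T τ cex n) 1) (m≤m⊔n _ (encode (τ n)))

    datum≤ : ∀ n → encode (τ n) ≤ suc k
    datum≤ n with τ n in eq
    ... | nothing = z≤n
    ... | just v  = s≤s (bounded {k} (sound (n , eq)))

    upper : ∀ n → T τ cex n ≤ suc k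
    upper zero    = z≤n
    upper (suc n) rewrite grows n = ⊔-lub (⊔-lub (upper n) (s≤s z≤n)) (datum≤ n)

    lower : ∀ n → suc K ≤ n → suc k ≤ T τ cex n
    lower (suc n) (s≤s K≤n) rewrite grows n with m≤n⇒m<n∨m≡n K≤n
    ... | inj₁ K<n  = ≤-trans (lower n K<n) (≤-trans (m≤m⊔n (T τ cex n) 1) (m≤m⊔n _ (encode (τ n))))
    ... | inj₂ refl rewrite proj₂ (complete (member {k} ≤-refl)) = m≤n⊔m (T τ cex n ⊔ 1) (suc k)

    settled : ∀ n → suc K ≤ n → T τ cex n ≡ suc k
    settled n K<n = ≤-antisym (upper n) (lower n K<n)

  cegis : CEGIS family
  cegis = engine , identifies

  no-cex : Sequence
  no-cex _ = nothing

  no-cex-ok : ∀ (E : Engine family) i {τ} → IsTrace (lang i) τ → IsCexSequence HCHECK E (lang i) τ no-cex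
  no-cex-ok E i (sound , _) n (m , m∉ , _ , j , _ , v , τj≡v , m<v) =
    m∉ (down-closed i (<⇒≤ m<v) (sound (j , τj≡v)))

  _⊳_ : List ℕ → ℕ → Sequence
  ([]      ⊳ x) n       = just x
  ((a ∷ l) ⊳ x) zero    = just a
  ((a ∷ l) ⊳ x) (suc n) = (l ⊳ x) n

  ⊳-prefix : ∀ l l′ x y n → n < length l → (l ⊳ x) n ≡ ((l ++ l′) ⊳ y) n
  ⊳-prefix (a ∷ l) l′ x y zero    _         = refl
  ⊳-prefix (a ∷ l) l′ x y (suc n) (s≤s n<l) = ⊳-prefix l l′ x y n n<l

  ⊳-replicate : ∀ l x m n → ((l ++ replicate m x) ⊳ x) n ≡ (l ⊳ x) n
  ⊳-replicate [] x zero    n       = refl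
  ⊳-replicate [] x (suc m) zero    = refl
  ⊳-replicate [] x (suc m) (suc n) = ⊳-replicate [] x m n
  ⊳-replicate (a ∷ l) x m zero     = refl
  ⊳-replicate (a ∷ l) x m (suc n)  = ⊳-replicate l x m n

  ⊳-last : ∀ l x → (l ⊳ x) (length l) ≡ just x
  ⊳-last []      x = refl
  ⊳-last (a ∷ l) x = ⊳-last l x

  -- Gold's argument for the segments

  module _ (E : Engine family) (identifies : Identifies HCHECK E) where
    open Engine E using () renaming (T to Tᴱ)

    -- Followed by `k` forever, such a list is a trace of the segment up to `k`, on which the engine
    -- must settle. All conditions concern positions inside the list.
    record Stage (k : ℕ) : Set where
      field
        examples   : List ℕ
        sound   : ∀ n v → n < length examples → (examples ⊳ k) n ≡ just v → v < k
        reached : ∀ j → j < k → ∃[ n ] n < length examples × (examples ⊳ k) n ≡ just j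

    open Stage

    trace : ∀ {k} (s : Stage k) → IsTrace (lang (suc k)) (examples s ⊳ k)
    trace {k} s = (λ { (n , eq) → member {k} (bound n eq) }) , λ {v} v∈ → hit v (bounded {k} v∈)
      where
      past : ∀ l n → length l ≤ n → (l ⊳ k) n ≡ just k
      past []      n       _         = refl
      past (_ ∷ l) (suc n) (s≤s l≤n) = past l n l≤n
      bound : ∀ n {v} → (examples s ⊳ k) n ≡ just v → v ≤ k
      bound n eq with n <? length (examples s)
      ... | yes n<l = <⇒≤ (sound s n _ n<l eq)
      ... | no  n≮l = ≤-reflexive (just-injective (trans (sym eq) (past (examples s) n (≮⇒≥ n≮l))))
      hit : ∀ v → v ≤ k → SMPL (examples s ⊳ k) v
      hit v v≤k with m≤n⇒m<n∨m≡n v≤k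
      ... | inj₁ v<k  = let n , _ , eq = reached s v v<k in n , eq
      ... | inj₂ refl = length (examples s) , ⊳-last (examples s) k

    converged : ∀ {k} (s : Stage k) → ConvergesTo HCHECK E (suc k) (examples s ⊳ k) no-cex
    converged {k} s = identifies (suc k) _ no-cex (trace s) (no-cex-ok E (suc k) (trace s))

    -- Enough copies of `k` for the engine to have settled; the additional one shows `k` even if the
    -- engine settles at once.
    extend : ∀ {k} → Stage k → List ℕ
    extend {k} s = examples s ++ replicate (suc (proj₁ (converged s))) k

    length-extend : ∀ {k} (s : Stage k) → length (extend s) ≡ length (examples s) + suc (proj₁ (converged s))
    length-extend {k} s = trans (length-++ (examples s)) (cong (length (examples s) +_) (length-replicate _))

    data<extend : ∀ {k} (s : Stage k) → length (examples s) < length (extend s)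
    data<extend s rewrite length-extend s = m<m+n _ (s≤s z≤n)

    extend-⊳ : ∀ {k} (s : Stage k) y n → n < length (extend s) → (extend s ⊳ y) n ≡ (examples s ⊳ k) n
    extend-⊳ {k} s y n n<l = begin
      (extend s ⊳ y) n                ≡⟨ ⊳-prefix (extend s) [] y k n n<l ⟩
      ((extend s ++ []) ⊳ k) n        ≡⟨ ⊳-prefix (extend s) [] k k n n<l ⟨
      (extend s ⊳ k) n                ≡⟨ ⊳-replicate (examples s) k (suc (proj₁ (converged s))) n ⟩
      (examples s ⊳ k) n                 ∎
      where open ≡-Reasoning

    next : ∀ {k} → Stage k → Stage (suc k)
    next {k} s = record
      { examples   = extend s
      ; sound   = λ n v n<l eq → s≤s (bounded {k} (proj₁ (trace s) (n , trans (sym (extend-⊳ s (suc k) n n<l)) eq)))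
      ; reached = hit
      }
      where
      hit : ∀ j → j < suc k → ∃[ n ] n < length (extend s) × (extend s ⊳ suc k) n ≡ just j
      hit j (s≤s j≤k) with m≤n⇒m<n∨m≡n j≤k
      ... | inj₁ j<k  = let n , n<l , eq = reached s j j<k
                            n<l′ = <-trans n<l (data<extend s)
                        in n , n<l′ , trans (extend-⊳ s (suc k) n n<l′) eq
      ... | inj₂ refl = length (examples s) , data<extend s ,
                        trans (extend-⊳ s (suc k) _ (data<extend s)) (⊳-last (examples s) k)

    stage : ∀ k → Stage k
    stage zero    = record { examples = [] ; sound = λ _ _ () ; reached = λ _ () }
    stage (suc k) = next (stage k)

    k≤length : ∀ k → k ≤ length (examples (stage k))
    k≤length zero    = z≤n
    k≤length (suc k) = ≤-<-trans (k≤length k) (data<extend (stage k))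

    -- The list of stage `suc n` is longer than `n`, and later stages only extend it.
    limit : Sequence
    limit n = (examples (stage (suc n)) ⊳ suc n) n

    stage-prefix : ∀ k d n → n < length (examples (stage k)) →
                   (examples (stage k) ⊳ k) n ≡ (examples (stage (d + k)) ⊳ (d + k)) n × n < length (examples (stage (d + k)))
    stage-prefix k zero    n n<l = refl , n<l
    stage-prefix k (suc d) n n<l =
      let eq , n<l′ = stage-prefix k d n n<l
          n<l″      = <-trans n<l′ (data<extend (stage (d + k)))
      in trans eq (sym (extend-⊳ (stage (d + k)) _ n n<l″)) , n<l″

    limit-prefix : ∀ k n → n < length (examples (stage k)) → limit n ≡ (examples (stage k) ⊳ k) n
    limit-prefix k n n<l = begin
      limit n                                        ≡⟨ proj₁ (stage-prefix (suc n) k n (k≤length (suc n))) ⟩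
      (examples (stage (k + suc n)) ⊳ (k + suc n)) n ≡⟨ cong (λ j → (examples (stage j) ⊳ j) n) (+-comm k (suc n)) ⟩
      (examples (stage (suc n + k)) ⊳ (suc n + k)) n ≡⟨ proj₁ (stage-prefix k (suc n) n n<l) ⟨
      (examples (stage k) ⊳ k) n                     ∎
      where open ≡-Reasoning

    limit-trace : IsTrace (lang 0) limit
    limit-trace = (λ _ → refl) , λ {v} _ →
      let n , n<l , eq = reached (stage (suc v)) v ≤-refl in n , trans (limit-prefix (suc v) n n<l) eq

    -- Up to the end of the padding, `limit` agrees with a trace of the segment up to `k`, on which
    -- the engine has converged by then. So along this trace of ℕ it passes through every segment.
    hypothesis : ∀ k → IndexedFamily._≈ᴾ_ family (Tᴱ limit no-cex (length (examples (stage (suc k))))) (suc k)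
    hypothesis k = subst (λ i → IndexedFamily._≈ᴾ_ family i (suc k))
      (T-prefix E (length (extend (stage k)))
        (λ n n<l → sym (trans (limit-prefix (suc k) n n<l) (extend-⊳ (stage k) (suc k) n n<l)))
        (λ _ _ → refl))
      (proj₂ (converged (stage k)) _
        (≤-trans (n≤1+n _) (≤-trans (m≤n+m _ _) (≤-reflexive (sym (length-extend (stage k)))))))

    ¬hcegis : ⊥
    ¬hcegis =
      let N , conv = identifies 0 limit no-cex limit-trace (no-cex-ok E 0 limit-trace)
          N≤       = ≤-trans (n≤1+n N) (k≤length (suc N))
      in 0≉suc {N} (λ v → trans (sym (conv _ N≤ v)) (hypothesis N v))

CEGIS⊈HCEGIS : CEGIS ⊈ HCEGIS
CEGIS⊈HCEGIS ⊆ = let E , identifies = ⊆ Segments.cegis in Segments.¬hcegis E identifies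

-- The family of the languages S p, R u and G b k

b2n : Bool → ℕ
b2n false = 0
b2n true  = 1

odd : ℕ → Bool
odd zero    = false
odd (suc n) = not (odd n)

half : ℕ → ℕ
half zero    = 0
half (suc n) = half n + b2n (odd n)

-- The quotient of `u` by 2^e: `bit e u` is the binary digit of weight 2^e, and `shr e u ≡ 0` says
-- that u < 2^e.
shr : ℕ → ℕ → ℕ
shr zero    u = u
shr (suc e) u = half (shr e u)

bit : ℕ → ℕ → Bool
bit e u = odd (shr e u)

-- Counts the odd positions below 2n with binary digit 1. All digits of `u` are covered by
-- `odds u u`.
odds : ℕ → ℕ → ℕ
odds zero    u = 0
odds (suc n) u = odds n u + b2n (bit (suc (n + n)) u)

-- 2^n - 1, the largest number with `n` binary digits.
full : ℕ → ℕ
full zero    = 0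
full (suc n) = suc (full n + full n)

-- The remainder by 6 as a primitive recursion; `5 ∸ tag v` vanishes exactly when it wraps. Likewise
-- `arg` is the quotient.
tag : ℕ → ℕ
tag zero    = 0
tag (suc v) = ifz (5 ∸ tag v) 0 (suc (tag v))

arg : ℕ → ℕ
arg zero    = 0
arg (suc v) = arg v + ifz (5 ∸ tag v) 1 0

data Mod6 : ℕ → Set where
  res₀ : ∀ a → Mod6 (a * 6)
  res₁ : ∀ a → Mod6 (1 + a * 6)
  res₂ : ∀ a → Mod6 (2 + a * 6)
  res₃ : ∀ a → Mod6 (3 + a * 6)
  res₄ : ∀ a → Mod6 (4 + a * 6)
  res₅ : ∀ a → Mod6 (5 + a * 6)

mod6 : ∀ v → Mod6 v
mod6 zero = res₀ 0
mod6 (suc v) with mod6 v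
... | res₀ a = res₁ a
... | res₁ a = res₂ a
... | res₂ a = res₃ a
... | res₃ a = res₄ a
... | res₄ a = res₅ a
... | res₅ a = res₀ (suc a)

tag-*6 : ∀ a → tag (a * 6) ≡ 0
tag-*6 zero    = refl
tag-*6 (suc a) rewrite tag-*6 a = refl

arg-*6 : ∀ a → arg (a * 6) ≡ a
arg-*6 zero    = refl
arg-*6 (suc a) rewrite tag-*6 a | arg-*6 a = trans (+-comm _ 1) (cong suc
  (trans (+-identityʳ _) (trans (+-identityʳ _) (trans (+-identityʳ _) (trans (+-identityʳ _) (+-identityʳ a))))))

-- Elements and indices are numbers 6a + t, read through tag and arg as
-- 6e: ord e, 6a+1: zed a, 6a+2: two a, 6b+3+r: gee b k    (elements),
-- 6a: S false, 6a+1: S true, 6u+2: R u, 6b+3+r: G b k     (indices; S p has many).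
data Kind : Set where
  probe : Bool → Kind
  pure  : Kind

data Elt : Set where
  ord zed two : ℕ → Elt
  gee         : ℕ → Kind → Elt

data St : Set where
  S : Bool → St
  R : ℕ → St
  G : ℕ → Kind → St

mkElt : ℕ → ℕ → Elt
mkElt 0 a = ord a
mkElt 1 a = zed a
mkElt 2 a = two a
mkElt 3 a = gee a (probe false)
mkElt 4 a = gee a (probe true)
mkElt _ a = gee a pure

mkSt : ℕ → ℕ → St
mkSt 0 a = S false
mkSt 1 a = S true
mkSt 2 a = R a
mkSt 3 a = G a (probe false)
mkSt 4 a = G a (probe true)
mkSt _ a = G a pure

elt : ℕ → Elt
elt v = mkElt (tag v) (arg v)

dec : ℕ → St
dec i = mkSt (tag i) (arg i)

kind# : Kind → ℕ
kind# (probe false) = 3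
kind# (probe true)  = 4
kind# pure          = 5

value : Elt → ℕ
value (ord a)   = a * 6
value (zed a)   = 1 + a * 6
value (two a)   = 2 + a * 6
value (gee a k) = kind# k + a * 6

enc : St → ℕ
enc (S p)   = b2n p
enc (R u)   = 2 + u * 6
enc (G b k) = kind# k + b * 6

tag-arg : ∀ t a → t ≤ 5 → tag (t + a * 6) ≡ t × arg (t + a * 6) ≡ a
tag-arg 0 a _ = tag-*6 a , arg-*6 a
tag-arg (suc t) a (s≤s t≤4) with tag-arg t a (m≤n⇒m≤1+n t≤4)
... | tt , aa rewrite tt | aa with t | t≤4
...   | 0 | _ = refl , +-identityʳ a
...   | 1 | _ = refl , +-identityʳ a
...   | 2 | _ = refl , +-identityʳ a
...   | 3 | _ = refl , +-identityʳ a
...   | 4 | _ = refl , +-identityʳ a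
...   | suc (suc (suc (suc (suc _)))) | s≤s (s≤s (s≤s (s≤s ())))

elt-value : ∀ x → elt (value x) ≡ x
elt-value (ord a) rewrite tag-*6 a | arg-*6 a = refl
elt-value (zed a) with tt , aa ← tag-arg 1 a (s≤s z≤n) rewrite tt | aa = refl
elt-value (two a) with tt , aa ← tag-arg 2 a (s≤s (s≤s z≤n)) rewrite tt | aa = refl
elt-value (gee a (probe false)) with tt , aa ← tag-arg 3 a (s≤s (s≤s (s≤s z≤n))) rewrite tt | aa = refl
elt-value (gee a (probe true))  with tt , aa ← tag-arg 4 a (s≤s (s≤s (s≤s (s≤s z≤n)))) rewrite tt | aa = refl
elt-value (gee a pure)          with tt , aa ← tag-arg 5 a ≤-refl rewrite tt | aa = refl

value-elt : ∀ v → value (elt v) ≡ v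
value-elt v with mod6 v
... | res₀ a = cong value (elt-value (ord a))
... | res₁ a = cong value (elt-value (zed a))
... | res₂ a = cong value (elt-value (two a))
... | res₃ a = cong value (elt-value (gee a (probe false)))
... | res₄ a = cong value (elt-value (gee a (probe true)))
... | res₅ a = cong value (elt-value (gee a pure))

dec-enc : ∀ s → dec (enc s) ≡ s
dec-enc (S false) = refl
dec-enc (S true)  = refl
dec-enc (R a) with tt , aa ← tag-arg 2 a (s≤s (s≤s z≤n)) rewrite tt | aa = refl
dec-enc (G a (probe false)) with tt , aa ← tag-arg 3 a (s≤s (s≤s (s≤s z≤n))) rewrite tt | aa = refl
dec-enc (G a (probe true))  with tt , aa ← tag-arg 4 a (s≤s (s≤s (s≤s (s≤s z≤n)))) rewrite tt | aa = refl
dec-enc (G a pure)          with tt , aa ← tag-arg 5 a ≤-refl rewrite tt | aa = refl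

-- Each hole is an even number that only the other language `S` contains, so it refutes the wrong
-- one of the two; it is small, hence soon below the history.
hole : Bool → ℕ
hole false = 0
hole true  = 2

inS : Bool → ℕ → Bool
inS p e = not (odd e) ∧ not (e ≡ᵇ hole p)

-- Unless the probe is itself the target, silence about it bounds the history by its junk. For
-- `probe p` it says moreover that no error of `S p` up to `b` lies below the history.
inProbe : ℕ → Kind → ℕ → Bool
inProbe b (probe p) e = (e ≤ᵇ b) ∧ inS p e
inProbe b pure      e = false

-- R u holds the bits of u as ord, and zed to be infinite; two 0 is there so that
-- every R u has a member that is odd or two 0, and hence is not a member of any S p.
mem : St → Elt → Bool
mem (S p)   (ord e)    = inS p e
mem (S p)   _          = false
mem (R u)   (ord e)    = bit e u
mem (R u)   (zed _)    = true
mem (R u)   (two a)    = (a ≡ᵇ 0) ∧ (odds u u ≡ᵇ 0)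
mem (R u)   (gee _ _)  = false
mem (G b k) (ord e)    = inProbe b k e
mem (G b k) (gee b′ k′) = (b ≡ᵇ b′) ∧ (kind# k ≡ᵇ kind# k′)
mem (G b k) _          = false

template : ℕ → ℕ → ℕ
template i v = b2n (mem (dec i) (elt v))

pick : ∀ {A : Set} → ℕ → A → A → A
pick zero    a b = a
pick (suc _) a b = b

start : St
start = G 0 (probe false)

next : ℕ → Kind → St
next b (probe false) = G b (probe true)
next b (probe true)  = G b pure
next b pure          = G (suc b) (probe false)

-- ⊥ is presented as `two 0`, which no clause of `move` singles out.
observed : Maybe ℕ → Elt
observed nothing  = two 0
observed (just v) = elt v

-- A silent probe leads to S p; a silent pure probe shows that all data lie below it,
-- so that the search for R t can start at a superset of everything seen.  R u is
-- left for R (u - 1): supersets are numerically larger, so R t is met before its subsets.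
move : St → ℕ → Elt → ℕ → St
move _       x (gee b k) _       = G b k
move (S p)   x _         c       = pick c (S p) start
move (R u)   x (ord e)   c       = pick (shr e u) start (pick c (R u) (R (pred u)))
move (R u)   x _         c       = pick c (R u) (R (pred u))
move (G b (probe p)) x (ord e) c = pick c (pick (e ∸ b) (G b (probe p)) (S p)) (next (b ⊔ x) (probe p))
move (G b pure) x (ord e) c      = pick c (pick (e ∸ b) (G b pure) (next (b ⊔ x) pure)) (next (b ⊔ x) pure)
move (G b pure) x (zed _) c      = pick c (R (full (2 + enc (G b pure)))) (next (b ⊔ x) pure)
move (G b k) x _         c       = pick c (G b k) (next (b ⊔ x) k)

step : ℕ → Maybe ℕ → Maybe ℕ → ℕ
step i x c = enc (move (dec i) (encode x) (observed x) (encode c))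

-- Recursiveness of the family and of the engine

b2n-not : ∀ b → 1 ∸ b2n b ≡ b2n (not b)
b2n-not false = refl
b2n-not true  = refl

odd-recursive : Recursive (fun₁ (λ n → b2n (odd n)))
odd-recursive = by-prec₁ (litᵉ 0) (litᵉ 1 ∸ᵉ var 1F) refl (λ k → b2n-not (odd k))

half-recursive : Recursive (fun₁ half)
half-recursive = by-prec₁ (litᵉ 0) (var 1F +ᵉ call₁ odd-recursive (var 0F)) refl (λ _ → refl)

shr-recursive : Recursive (fun₂ shr)
shr-recursive = by-prec₂ (var 0F) (call₁ half-recursive (var 1F)) (λ _ → refl) (λ _ _ → refl)

bitᵉ : ∀ {n} → Exp n → Exp n → Exp n
bitᵉ e u = call₁ odd-recursive (call₂ shr-recursive e u)

odds-recursive : Recursive (fun₂ odds)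
odds-recursive = by-prec₂ (litᵉ 0) (var 1F +ᵉ bitᵉ (sucᵉ (var 0F +ᵉ var 0F)) (var 2F)) (λ _ → refl) (λ _ _ → refl)

full-recursive : Recursive (fun₁ full)
full-recursive = by-prec₁ (litᵉ 0) (sucᵉ (var 1F +ᵉ var 1F)) refl (λ _ → refl)

tag-recursive : Recursive (fun₁ tag)
tag-recursive = by-prec₁ (litᵉ 0) (ifzᵉ (litᵉ 5 ∸ᵉ var 1F) (litᵉ 0) (sucᵉ (var 1F))) refl (λ _ → refl)

arg-recursive : Recursive (fun₁ arg)
arg-recursive = by-prec₁ (litᵉ 0)
  (var 1F +ᵉ ifzᵉ (litᵉ 5 ∸ᵉ call₁ tag-recursive (var 0F)) (litᵉ 1) (litᵉ 0)) refl (λ _ → refl)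

≤ᵇ-recursive : Recursive (fun₂ (λ a b → b2n (a ≤ᵇ b)))
≤ᵇ-recursive = by-exp₂ (litᵉ 1 ∸ᵉ (var 0F ∸ᵉ var 1F)) go
  where
  go : ∀ a b → 1 ∸ (a ∸ b) ≡ b2n (a ≤ᵇ b)
  go zero          b       = cong (1 ∸_) (0∸n≡0 b)
  go (suc a)       zero    = 0∸n≡0 a
  go (suc zero)    (suc b) = go zero b
  go (suc (suc a)) (suc b) = go (suc a) b

≡ᵇ-recursive : Recursive (fun₂ (λ a b → b2n (a ≡ᵇ b)))
≡ᵇ-recursive = by-exp₂ (litᵉ 1 ∸ᵉ ((var 0F ∸ᵉ var 1F) +ᵉ (var 1F ∸ᵉ var 0F))) go
  where
  go : ∀ a b → 1 ∸ ((a ∸ b) + (b ∸ a)) ≡ b2n (a ≡ᵇ b)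
  go zero    zero    = refl
  go zero    (suc b) = 0∸n≡0 b
  go (suc a) zero    = 0∸n≡0 (a + 0)
  go (suc a) (suc b) = go a b

case6ᵉ : ∀ {n} → Exp n → (_ _ _ _ _ _ : Exp n) → Exp n
case6ᵉ t e₀ e₁ e₂ e₃ e₄ e₅ =
  ifzᵉ t e₀ (ifzᵉ (pr t) e₁ (ifzᵉ (pr (pr t)) e₂ (ifzᵉ (pr (pr (pr t))) e₃ (ifzᵉ (pr (pr (pr (pr t)))) e₄ e₅))))
  where
  pr : ∀ {n} → Exp n → Exp n
  pr = call₁ pred-recursive

notᵉ : ∀ {n} → Exp n → Exp n
notᵉ e = litᵉ 1 ∸ᵉ e

inSᵉ : ∀ {n} → ℕ → Exp n → Exp n
inSᵉ h e = notᵉ (call₁ odd-recursive e) *ᵉ notᵉ (call₂ ≡ᵇ-recursive e (litᵉ h))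

b2n-∧ : ∀ a b → b2n a * b2n b ≡ b2n (a ∧ b)
b2n-∧ false b     = refl
b2n-∧ true  false = refl
b2n-∧ true  true  = refl

inS-num : ∀ p e → (1 ∸ b2n (odd e)) * (1 ∸ b2n (e ≡ᵇ hole p)) ≡ b2n (inS p e)
inS-num p e = trans (cong₂ _*_ (b2n-not (odd e)) (b2n-not (e ≡ᵇ hole p))) (b2n-∧ (not (odd e)) _)

-- Variables: tag and arg of the state, tag and arg of the element. The outer case is on the
-- element, the inner ones are on the state.
memᵉ : Exp 4
memᵉ = case6ᵉ (var 2F)
  (case6ᵉ (var 0F) (inSᵉ 0 (var 3F)) (inSᵉ 2 (var 3F)) (bitᵉ (var 3F) (var 1F))
    (call₂ ≤ᵇ-recursive (var 3F) (var 1F) *ᵉ inSᵉ 0 (var 3F))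
    (call₂ ≤ᵇ-recursive (var 3F) (var 1F) *ᵉ inSᵉ 2 (var 3F))
    (litᵉ 0))
  (case6ᵉ (var 0F) (litᵉ 0) (litᵉ 0) (litᵉ 1) (litᵉ 0) (litᵉ 0) (litᵉ 0))
  (case6ᵉ (var 0F) (litᵉ 0) (litᵉ 0)
    (call₂ ≡ᵇ-recursive (var 3F) (litᵉ 0) *ᵉ
     call₂ ≡ᵇ-recursive (call₂ odds-recursive (var 1F) (var 1F)) (litᵉ 0))
    (litᵉ 0) (litᵉ 0) (litᵉ 0))
  (case6ᵉ (var 0F) (litᵉ 0) (litᵉ 0) (litᵉ 0) (call₂ ≡ᵇ-recursive (var 1F) (var 3F)) (litᵉ 0) (litᵉ 0))
  (case6ᵉ (var 0F) (litᵉ 0) (litᵉ 0) (litᵉ 0) (litᵉ 0) (call₂ ≡ᵇ-recursive (var 1F) (var 3F)) (litᵉ 0))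
  (case6ᵉ (var 0F) (litᵉ 0) (litᵉ 0) (litᵉ 0) (litᵉ 0) (litᵉ 0) (call₂ ≡ᵇ-recursive (var 1F) (var 3F)))

pattern 5+_ n = suc (suc (suc (suc (suc n))))

∧-trueʳ : ∀ b → b2n b ≡ b2n (b ∧ true)
∧-trueʳ false = refl
∧-trueʳ true  = refl

∧-falseʳ : ∀ b → 0 ≡ b2n (b ∧ false)
∧-falseʳ false = refl
∧-falseʳ true  = refl

mem-num : ∀ t a t′ a′ → eval memᵉ (t ∷ a ∷ t′ ∷ a′ ∷ []) ≡ b2n (mem (mkSt t a) (mkElt t′ a′))
mem-num 0 a 0 e = inS-num false e
mem-num 1 a 0 e = inS-num true e
mem-num 2 a 0 e = refl
mem-num 3 a 0 e = trans (cong (b2n (e ≤ᵇ a) *_) (inS-num false e)) (b2n-∧ (e ≤ᵇ a) _)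
mem-num 4 a 0 e = trans (cong (b2n (e ≤ᵇ a) *_) (inS-num true e)) (b2n-∧ (e ≤ᵇ a) _)
mem-num (5+ _) a 0 e = refl
mem-num 0 a 1 e = refl
mem-num 1 a 1 e = refl
mem-num 2 a 1 e = refl
mem-num 3 a 1 e = refl
mem-num 4 a 1 e = refl
mem-num (5+ _) a 1 e = refl
mem-num 0 a 2 e = refl
mem-num 1 a 2 e = refl
mem-num 2 a 2 e = b2n-∧ (e ≡ᵇ 0) _
mem-num 3 a 2 e = refl
mem-num 4 a 2 e = refl
mem-num (5+ _) a 2 e = refl
mem-num 0 a 3 e = refl
mem-num 1 a 3 e = refl
mem-num 2 a 3 e = refl
mem-num 3 a 3 e = ∧-trueʳ (a ≡ᵇ e)
mem-num 4 a 3 e = ∧-falseʳ (a ≡ᵇ e)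
mem-num (5+ _) a 3 e = ∧-falseʳ (a ≡ᵇ e)
mem-num 0 a 4 e = refl
mem-num 1 a 4 e = refl
mem-num 2 a 4 e = refl
mem-num 3 a 4 e = ∧-falseʳ (a ≡ᵇ e)
mem-num 4 a 4 e = ∧-trueʳ (a ≡ᵇ e)
mem-num (5+ _) a 4 e = ∧-falseʳ (a ≡ᵇ e)
mem-num 0 a (5+ _) e = refl
mem-num 1 a (5+ _) e = refl
mem-num 2 a (5+ _) e = refl
mem-num 3 a (5+ _) e = ∧-falseʳ (a ≡ᵇ e)
mem-num 4 a (5+ _) e = ∧-falseʳ (a ≡ᵇ e)
mem-num (5+ _) a (5+ _) e = ∧-trueʳ (a ≡ᵇ e)

tagᵉ argᵉ : ∀ {n} → Exp n → Exp n
tagᵉ = call₁ tag-recursive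
argᵉ = call₁ arg-recursive

template-recursive : Recursive (fun₂ template)
template-recursive = by-exp₂ (call (exp-recursive memᵉ) (tagᵉ (var 0F) ∷ argᵉ (var 0F) ∷ tagᵉ (var 1F) ∷ argᵉ (var 1F) ∷ []))
  (λ i v → mem-num (tag i) (arg i) (tag v) (arg v))

-- Variables: tag and arg of the state; code, tag and arg of the datum; code of the counterexample.
moveᵉ : Exp 6
moveᵉ = case6ᵉ tˣ
  (case6ᵉ t (ifzᵉ c (litᵉ 0) (litᵉ 3)) (ifzᵉ c (litᵉ 1) (litᵉ 3))
    (ifzᵉ (call₂ shr-recursive aˣ a) (litᵉ 3) stayR)
    (ifzᵉ c (ifzᵉ (aˣ ∸ᵉ a) (at 3) (litᵉ 0)) (onward 4))
    (ifzᵉ c (ifzᵉ (aˣ ∸ᵉ a) (at 4) (litᵉ 1)) (onward 5))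
    (ifzᵉ c (ifzᵉ (aˣ ∸ᵉ a) (at 5) wrap) wrap))
  (other (litᵉ 2 +ᵉ call₁ full-recursive (sucᵉ (sucᵉ (at 5))) *ᵉ litᵉ 6))
  (other (at 5))
  (litᵉ 3 +ᵉ aˣ *ᵉ litᵉ 6) (litᵉ 4 +ᵉ aˣ *ᵉ litᵉ 6) (litᵉ 5 +ᵉ aˣ *ᵉ litᵉ 6)
  where
  t a x tˣ aˣ c : Exp 6
  t = var 0F ; a = var 1F ; x = var 2F ; tˣ = var 3F ; aˣ = var 4F ; c = var (suc 4F)
  at onward : ℕ → Exp 6
  at k     = litᵉ k +ᵉ a *ᵉ litᵉ 6
  onward k = litᵉ k +ᵉ (a ⊔ᵉ x) *ᵉ litᵉ 6
  wrap stayR : Exp 6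
  wrap   = litᵉ 3 +ᵉ sucᵉ (a ⊔ᵉ x) *ᵉ litᵉ 6
  stayR  = ifzᵉ c (at 2) (litᵉ 2 +ᵉ call₁ pred-recursive a *ᵉ litᵉ 6)
  other : Exp 6 → Exp 6
  other last = case6ᵉ t (ifzᵉ c (litᵉ 0) (litᵉ 3)) (ifzᵉ c (litᵉ 1) (litᵉ 3)) stayR
    (ifzᵉ c (at 3) (onward 4)) (ifzᵉ c (at 4) (onward 5)) (ifzᵉ c last wrap)

enc-pick : ∀ n s s′ → ifz n (enc s) (enc s′) ≡ enc (pick n s s′)
enc-pick zero    s s′ = refl
enc-pick (suc n) s s′ = refl

enc-pick₁ : ∀ m n s s′ s″ → ifz m (ifz n (enc s) (enc s′)) (enc s″) ≡ enc (pick m (pick n s s′) s″)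
enc-pick₁ zero    n s s′ s″ = enc-pick n s s′
enc-pick₁ (suc m) n s s′ s″ = refl

enc-pick₂ : ∀ m n s s′ s″ → ifz m (enc s) (ifz n (enc s′) (enc s″)) ≡ enc (pick m s (pick n s′ s″))
enc-pick₂ zero    n s s′ s″ = refl
enc-pick₂ (suc m) n s s′ s″ = enc-pick n s′ s″

move-num : ∀ t a x t′ a′ c → eval moveᵉ (t ∷ a ∷ x ∷ t′ ∷ a′ ∷ c ∷ []) ≡ enc (move (mkSt t a) x (mkElt t′ a′) c)
move-num 0 a x 0 e c = enc-pick c (S false) start
move-num 1 a x 0 e c = enc-pick c (S true) start
move-num 2 a x 0 e c = enc-pick₂ (shr e a) c start (R a) (R (pred a))
move-num 3 a x 0 e c = enc-pick₁ c (e ∸ a) (G a (probe false)) (S false) (G (a ⊔ x) (probe true))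
move-num 4 a x 0 e c = enc-pick₁ c (e ∸ a) (G a (probe true)) (S true) (G (a ⊔ x) pure)
move-num (5+ _) a x 0 e c = enc-pick₁ c (e ∸ a) (G a pure) (G (suc (a ⊔ x)) (probe false)) (G (suc (a ⊔ x)) (probe false))
move-num 0 a x 1 e c = enc-pick c (S false) start
move-num 1 a x 1 e c = enc-pick c (S true) start
move-num 2 a x 1 e c = enc-pick c (R a) (R (pred a))
move-num 3 a x 1 e c = enc-pick c (G a (probe false)) (G (a ⊔ x) (probe true))
move-num 4 a x 1 e c = enc-pick c (G a (probe true)) (G (a ⊔ x) pure)
move-num (5+ _) a x 1 e c = enc-pick c (R (full (2 + enc (G a pure)))) (G (suc (a ⊔ x)) (probe false))
move-num 0 a x 2 e c = enc-pick c (S false) start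
move-num 1 a x 2 e c = enc-pick c (S true) start
move-num 2 a x 2 e c = enc-pick c (R a) (R (pred a))
move-num 3 a x 2 e c = enc-pick c (G a (probe false)) (G (a ⊔ x) (probe true))
move-num 4 a x 2 e c = enc-pick c (G a (probe true)) (G (a ⊔ x) pure)
move-num (5+ _) a x 2 e c = enc-pick c (G a pure) (G (suc (a ⊔ x)) (probe false))
move-num 0 a x 3 e c = refl
move-num 1 a x 3 e c = refl
move-num 2 a x 3 e c = refl
move-num 3 a x 3 e c = refl
move-num 4 a x 3 e c = refl
move-num (5+ _) a x 3 e c = refl
move-num 0 a x 4 e c = refl
move-num 1 a x 4 e c = refl
move-num 2 a x 4 e c = refl
move-num 3 a x 4 e c = refl
move-num 4 a x 4 e c = refl
move-num (5+ _) a x 4 e c = refl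
move-num 0 a x (5+ _) e c = refl
move-num 1 a x (5+ _) e c = refl
move-num 2 a x (5+ _) e c = refl
move-num 3 a x (5+ _) e c = refl
move-num 4 a x (5+ _) e c = refl
move-num (5+ _) a x (5+ _) e c = refl

stepᵉ : Exp 3
stepᵉ = call (exp-recursive moveᵉ)
  ( tagᵉ (var 0F) ∷ argᵉ (var 0F) ∷ var 1F
  ∷ ifzᵉ (var 1F) (litᵉ 2) (tagᵉ (call₁ pred-recursive (var 1F)))
  ∷ ifzᵉ (var 1F) (litᵉ 0) (argᵉ (call₁ pred-recursive (var 1F)))
  ∷ var 2F ∷ [])

step-num : ∀ i x c → eval stepᵉ (i ∷ encode x ∷ encode c ∷ []) ≡ step i x c
step-num i nothing  c = move-num (tag i) (arg i) 0 2 0 (encode c)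
step-num i (just v) c = move-num (tag i) (arg i) (suc v) (tag v) (arg v) (encode c)

-- Binary digits

odd+half : ∀ n → n ≡ b2n (odd n) + (half n + half n)
odd+half zero = refl
odd+half (suc n) with odd n | odd+half n
... | false | eq rewrite +-identityʳ (half n) = cong suc eq
... | true  | eq = trans (cong suc eq) (lemma (half n))
  where
  lemma : ∀ h → suc (suc (h + h)) ≡ (h + 1) + (h + 1)
  lemma h rewrite +-comm h 1 | +-suc h h = refl

half≤ : ∀ n → half (suc n) ≤ n
half≤ n with odd n | odd+half n
... | false | eq rewrite +-identityʳ (half n) = subst (half n ≤_) (sym eq) (m≤m+n _ _)
... | true  | eq rewrite +-comm (half n) 1   = subst (suc (half n) ≤_) (sym eq) (s≤s (m≤m+n _ _))

half-≤-pred : ∀ n → half n ≤ n ∸ 1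
half-≤-pred zero    = z≤n
half-≤-pred (suc n) = half≤ n

half-mono : ∀ {m n} → m ≤ n → half m ≤ half n
half-mono {n = zero} z≤n = z≤n
half-mono {m} {suc n} m≤n with m≤n⇒m<n∨m≡n m≤n
... | inj₁ (s≤s m≤n′) = ≤-trans (half-mono m≤n′) (m≤m+n _ _)
... | inj₂ refl        = ≤-refl

half-double : ∀ n → half (n + n) ≡ n × odd (n + n) ≡ false
half-double zero = refl , refl
half-double (suc n) rewrite +-suc n n with half (n + n) | odd (n + n) | half-double n
... | h | o | refl , refl = trans (cong (_+ 1) (+-identityʳ h)) (+-comm h 1) , refl

half-suc-double : ∀ n → half (suc (n + n)) ≡ n × odd (suc (n + n)) ≡ true
half-suc-double n with half (n + n) | odd (n + n) | half-double n
... | h | o | refl , refl = +-identityʳ h , refl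

shr-half : ∀ e u → shr e (half u) ≡ shr (suc e) u
shr-half zero    u = refl
shr-half (suc e) u = cong half (shr-half e u)

shr-zero : ∀ e → shr e 0 ≡ 0
shr-zero zero    = refl
shr-zero (suc e) = cong half (shr-zero e)

shr-shr : ∀ k e u → shr k (shr e u) ≡ shr (k + e) u
shr-shr zero    e u = refl
shr-shr (suc k) e u = cong half (shr-shr k e u)

shr-mono : ∀ e {u v} → u ≤ v → shr e u ≤ shr e v
shr-mono zero    u≤v = u≤v
shr-mono (suc e) u≤v = half-mono (shr-mono e u≤v)

shr≤∸ : ∀ e u → shr e u ≤ u ∸ e
shr≤∸ zero    u = ≤-refl
shr≤∸ (suc e) u = ≤-trans (half-≤-pred (shr e u))
  (≤-trans (∸-monoˡ-≤ 1 (shr≤∸ e u)) (≤-reflexive (trans (∸-+-assoc u e 1) (cong (u ∸_) (+-comm e 1)))))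

shr-large : ∀ {e u} → u ≤ e → shr e u ≡ 0
shr-large {e} {u} u≤e = n≤0⇒n≡0 (subst (shr e u ≤_) (m≤n⇒m∸n≡0 u≤e) (shr≤∸ e u))

bit-large : ∀ {e u} → u ≤ e → bit e u ≡ false
bit-large u≤e = cong odd (shr-large u≤e)

bit⇒< : ∀ {e u} → bit e u ≡ true → e < u
bit⇒< {e} {u} b with e <? u
... | yes e<u = e<u
... | no  e≮u with () ← trans (sym b) (bit-large (≮⇒≥ e≮u))

bit⇒shr≢0 : ∀ e {u} → bit e u ≡ true → shr e u ≢ 0
bit⇒shr≢0 e b eq with () ← trans (sym b) (cong odd eq)

bit-suc : ∀ e u → bit (suc e) u ≡ bit e (half u)
bit-suc e u = cong odd (sym (shr-half e u))

-- A set of binary digits contained in another gives a number that is no larger. Either the halves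
-- are strictly ordered, or the lowest digit decides.
⊈-smaller : ∀ u v → u < v → ∃[ e ] bit e v ≡ true × bit e u ≡ false
⊈-smaller u v = <-rec (λ v → ∀ u → u < v → ∃[ e ] bit e v ≡ true × bit e u ≡ false) go v u
  where
  go : ∀ v → (∀ {v′} → v′ < v → ∀ u → u < v′ → ∃[ e ] bit e v′ ≡ true × bit e u ≡ false) →
       ∀ u → u < v → ∃[ e ] bit e v ≡ true × bit e u ≡ false
  go (suc v) rec u u<v with half u <? half (suc v)
  ... | yes h<h = let e , ev , eu = rec (s≤s (half≤ v)) (half u) h<h
                  in suc e , trans (bit-suc e (suc v)) ev , trans (bit-suc e u) eu
  ... | no  h≮h with odd (suc v) in ov | odd u in ou | odd+half (suc v) | odd+half u
  ...   | true  | false | _  | _  = 0 , ov , ou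
  ...   | true  | true  | eqv | equ = ⊥-elim (<⇒≱ u<v (subst₂ _≤_ (sym eqv) (sym equ) (s≤s (+-mono-≤ (≮⇒≥ h≮h) (≮⇒≥ h≮h)))))
  ...   | false | true  | eqv | equ = ⊥-elim (<⇒≱ u<v (subst₂ _≤_ (sym eqv) (sym equ) (m≤n⇒m≤1+n (+-mono-≤ (≮⇒≥ h≮h) (≮⇒≥ h≮h)))))
  ...   | false | false | eqv | equ = ⊥-elim (<⇒≱ u<v (subst₂ _≤_ (sym eqv) (sym equ) (+-mono-≤ (≮⇒≥ h≮h) (≮⇒≥ h≮h))))

bits-injective : ∀ u v → (∀ e → bit e u ≡ bit e v) → u ≡ v
bits-injective u v eq with <-cmp u v
... | tri< u<v _ _ with e , ev , eu ← ⊈-smaller u v u<v with () ← trans (sym eu) (trans (eq e) ev)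
... | tri≈ _ u≡v _ = u≡v
... | tri> _ _ v<u with e , eu , ev ← ⊈-smaller v u v<u with () ← trans (sym ev) (trans (sym (eq e)) eu)

shr-full : ∀ n → shr n (full n) ≡ 0
shr-full zero    = refl
shr-full (suc n) = trans (sym (shr-half n _)) (trans (cong (shr n) (proj₁ (half-suc-double (full n)))) (shr-full n))

shr-≥ : ∀ {e e′} u → e ≤ e′ → shr e u ≡ 0 → shr e′ u ≡ 0
shr-≥ {e} {e′} u e≤e′ eq = begin
  shr e′ u              ≡⟨ cong (λ n → shr n u) (m∸n+n≡m e≤e′) ⟨
  shr (e′ ∸ e + e) u    ≡⟨ shr-shr (e′ ∸ e) e u ⟨
  shr (e′ ∸ e) (shr e u) ≡⟨ cong (shr (e′ ∸ e)) eq ⟩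
  shr (e′ ∸ e) 0        ≡⟨ shr-zero (e′ ∸ e) ⟩
  0                     ∎
  where open ≡-Reasoning

≤full : ∀ n u → shr n u ≡ 0 → u ≤ full n
≤full zero    u eq = ≤-reflexive eq
≤full (suc n) u eq with odd u | odd+half u | ≤full n (half u) (trans (shr-half n u) eq)
... | false | equ | h≤ = subst (_≤ _) (sym equ) (m≤n⇒m≤1+n (+-mono-≤ h≤ h≤))
... | true  | equ | h≤ = subst (_≤ _) (sym equ) (s≤s (+-mono-≤ h≤ h≤))

high-bit : ∀ n u → shr n u ≢ 0 → ∃[ e ] n ≤ e × bit e u ≡ true
high-bit n u ≢0 = let e , b , _ = ⊈-smaller 0 (shr n u) (n≢0⇒n>0 ≢0)
                  in e + n , m≤n+m n e , trans (cong odd (sym (shr-shr e n u))) b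

-- Membership in the languages of the family

≡ᵇ-refl : ∀ n → (n ≡ᵇ n) ≡ true
≡ᵇ-refl zero    = refl
≡ᵇ-refl (suc n) = ≡ᵇ-refl n

≡ᵇ-true : ∀ m n → (m ≡ᵇ n) ≡ true → m ≡ n
≡ᵇ-true m n eq = ≡ᵇ⇒≡ m n (Equivalence.from T-≡ eq)

≤ᵇ-true : ∀ m n → (m ≤ᵇ n) ≡ true → m ≤ n
≤ᵇ-true m n eq = ≤ᵇ⇒≤ m n (Equivalence.from T-≡ eq)

true-≤ᵇ : ∀ {m n} → m ≤ n → (m ≤ᵇ n) ≡ true
true-≤ᵇ m≤n = Equivalence.to T-≡ (≤⇒≤ᵇ m≤n)

∧-true : ∀ {a b} → a ∧ b ≡ true → a ≡ true × b ≡ true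
∧-true {true} {true} _ = refl , refl

kind#-injective : ∀ k k′ → kind# k ≡ kind# k′ → k ≡ k′
kind#-injective (probe false) (probe false) _ = refl
kind#-injective (probe true)  (probe true)  _ = refl
kind#-injective pure          pure          _ = refl
kind#-injective (probe false) (probe true)  ()
kind#-injective (probe true)  (probe false) ()
kind#-injective pure (probe false) ()
kind#-injective pure (probe true) ()

inS-hole : ∀ p q → p ≢ q → inS p (hole q) ≡ true
inS-hole false false p≢q = ⊥-elim (p≢q refl)
inS-hole false true  p≢q = refl
inS-hole true  false p≢q = refl
inS-hole true  true  p≢q = ⊥-elim (p≢q refl)

hole∉S : ∀ p → inS p (hole p) ≡ false
hole∉S false = refl
hole∉S true  = refl

even∈S : ∀ p n → inS p ((2 + n) + (2 + n)) ≡ true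
even∈S p n rewrite proj₂ (half-double (2 + n)) | +-suc n (suc n) with p
... | false = refl
... | true  = refl

gee∈G : ∀ b k → mem (G b k) (gee b k) ≡ true
gee∈G b k rewrite ≡ᵇ-refl b = ≡ᵇ-refl (kind# k)

gee∈G⇒≡ : ∀ b k b′ k′ → mem (G b k) (gee b′ k′) ≡ true → G b k ≡ G b′ k′
gee∈G⇒≡ b k b′ k′ p with ∧-true {b ≡ᵇ b′} p
... | bb , kk = cong₂ G (≡ᵇ-true b b′ bb) (kind#-injective k k′ (≡ᵇ-true _ _ kk))

-- `zed 0` marks the languages `R u`, and `gee b k` lies in `G b k` only. This gives `F-cong`: `S p`
-- has many indices, and an engine acting on `dec i` respects equality of programs because the
-- language determines the state.
mem-injective : ∀ s s′ → (∀ x → mem s x ≡ mem s′ x) → s ≡ s′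
mem-injective (S false) (S false) eq = refl
mem-injective (S true)  (S true)  eq = refl
mem-injective (S false) (S true)  eq with () ← eq (ord 0)
mem-injective (S true)  (S false) eq with () ← eq (ord 0)
mem-injective (S p)     (R u)     eq with () ← eq (zed 0)
mem-injective (R u)     (S p)     eq with () ← eq (zed 0)
mem-injective (R u)     (G b k)   eq with () ← eq (zed 0)
mem-injective (G b k)   (R u)     eq with () ← eq (zed 0)
mem-injective (S p)     (G b k)   eq with () ← trans (eq (gee b k)) (gee∈G b k)
mem-injective (G b k)   (S p)     eq with () ← trans (sym (eq (gee b k))) (gee∈G b k)
mem-injective (R u)     (R v)     eq = cong R (bits-injective u v (λ e → eq (ord e)))
mem-injective (G b k)   (G b′ k′) eq = sym (gee∈G⇒≡ b′ k′ b k (trans (sym (eq (gee b k))) (gee∈G b k)))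

b2n-1 : ∀ {b} → b2n b ≡ 1 → b ≡ true
b2n-1 {true} _ = refl

b2n-injective : ∀ {a b} → b2n a ≡ b2n b → a ≡ b
b2n-injective {false} {false} _ = refl
b2n-injective {true}  {true}  _ = refl

family : IndexedFamily
family = record
  { template  = template
  ; binary    = λ i v → binary (mem (dec i) (elt v))
  ; recursive = Recursive-cong (λ { (i ∷ v ∷ []) → refl }) template-recursive
  ; nonEmpty  = λ i → inhabited (dec i)
  }
  where
  binary : ∀ b → b2n b ≡ 0 ⊎ b2n b ≡ 1
  binary false = inj₁ refl
  binary true  = inj₂ refl
  inhabited : ∀ s → ∃[ v ] b2n (mem s (elt v)) ≡ 1
  inhabited (S false) = value (ord 4) , refl
  inhabited (S true)  = value (ord 4) , refl
  inhabited (R u)     = value (zed 0) , refl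
  inhabited (G b k)   = value (gee b k) , cong b2n (trans (cong (mem (G b k)) (elt-value (gee b k))) (gee∈G b k))

open IndexedFamily family using (lang; _≈ᴾ_)

≈⇒dec≡ : ∀ {i j} → i ≈ᴾ j → dec i ≡ dec j
≈⇒dec≡ {i} {j} i≈j = mem-injective (dec i) (dec j) λ x →
  subst (λ y → mem (dec i) y ≡ mem (dec j) y) (elt-value x) (b2n-injective (i≈j (value x)))

dec≡⇒≈ : ∀ {i j} → dec i ≡ dec j → i ≈ᴾ j
dec≡⇒≈ eq v = cong (λ s → b2n (mem s (elt v))) eq

engine : Engine family
engine = record
  { F           = step
  ; F-cong      = λ {i} {j} x c i≈j v → cong (λ s → template (enc (move s (encode x) (observed x) (encode c))) v) (≈⇒dec≡ {i} {j} i≈j)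
  ; F-recursive = Recursive-cong (λ { (i ∷ x ∷ c ∷ []) → on-codes stepᵉ step-num i x c }) (exp-recursive stepᵉ)
  ; initial     = enc start
  }

-- Identification with history-bounded counterexamples

true≢false : true ≢ false
true≢false ()

-- A history-bounded run read through `dec`, free of codes. `quiet` is the form in which ⊥ is used:
-- every error of an unrefuted hypothesis bounds the whole history from above.
record Play (t : St) : Set where
  field
    τ cex    : Sequence
    s        : ℕ → St
    s-zero   : s 0 ≡ start
    s-suc    : ∀ n → s (suc n) ≡ move (s n) (encode (τ n)) (observed (τ n)) (encode (cex n))
    sound    : ∀ n {v} → τ n ≡ just v → mem t (elt v) ≡ true
    complete : ∀ x → mem t x ≡ true → ∃[ n ] τ n ≡ just (value x)
    quiet    : ∀ n → cex n ≡ nothing → ∀ x → mem (s n) x ≡ true → mem t x ≡ false →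
               ∀ j → j < n → ∀ {v} → τ j ≡ just v → v ≤ value x
    refuted  : ∀ n {m} → cex n ≡ just m → mem (s n) (elt m) ≡ true × mem t (elt m) ≡ false ×
               ∃[ j ] j < n × ∃[ v ] τ j ≡ just v × m < v

module _ {t : St} (P : Play t) where
  open Play P

  no-refutation : ∀ n {m} → s n ≡ t → cex n ≢ just m
  no-refutation n sn≡t eq with in-s , out-t , _ ← refuted n eq
    = true≢false (trans (sym in-s) (trans (cong (λ s′ → mem s′ _) sn≡t) out-t))

  cex-nothing : ∀ n → s n ≡ t → cex n ≡ nothing
  cex-nothing n sn≡t with cex n in eq
  ... | nothing = refl
  ... | just m  = ⊥-elim (no-refutation n sn≡t eq)

  step-at : ∀ n {s′ x c} → s n ≡ s′ → τ n ≡ x → cex n ≡ c → s (suc n) ≡ move s′ (encode x) (observed x) (encode c)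
  step-at n refl refl refl = s-suc n

  stays : (∀ n → s n ≡ t → s (suc n) ≡ t) → ∀ {N} → s N ≡ t → ∀ n → N ≤ n → s n ≡ t
  stays stable {N} sN n N≤n = subst (λ m → s m ≡ t) (m+[n∸m]≡n N≤n) (go (n ∸ N))
    where
    go : ∀ d → s (N + d) ≡ t
    go zero    = trans (cong s (+-identityʳ N)) sN
    go (suc d) = trans (cong s (+-suc N d)) (stable (N + d) (go d))

G-silent : ∀ b k → move (G b k) 0 (two 0) 0 ≡ G b k
G-silent b (probe _) = refl
G-silent b pure      = refl

module Target-G {b : ℕ} {k : Kind} (P : Play (G b k)) where
  open Play P

  stable : ∀ n → s n ≡ G b k → s (suc n) ≡ G b k
  stable n sn with τ n in τn
  ... | nothing = trans (step-at P n sn τn (cex-nothing P n sn)) (G-silent b k)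
  ... | just v = trans (step-at P n sn τn (cex-nothing P n sn)) (inside k (elt v) (sound n τn))
    where
    inside : ∀ k x → mem (G b k) x ≡ true → move (G b k) (suc v) x 0 ≡ G b k
    -- The numbers in a probe are at most `b`, so they never trigger the exit to `S p`.
    inside (probe p) (ord e) e∈ rewrite m≤n⇒m∸n≡0 (≤ᵇ-true e b (proj₁ (∧-true {e ≤ᵇ b} e∈))) = refl
    inside k (gee b′ k′) g∈ = sym (gee∈G⇒≡ b k b′ k′ g∈)

  converges : ∃[ N ] ∀ n → N ≤ n → s n ≡ G b k
  converges =
    let j , τj = complete (gee b k) (gee∈G b k)
    in suc j , stays P stable (trans (step-at P j refl τj refl) (cong (λ x → move (s j) (suc (value (gee b k))) x (encode (cex j))) (elt-value (gee b k))))

bound : (τ : Sequence) (n : ℕ) → ∃[ M ] ∀ j → j < n → ∀ {v} → τ j ≡ just v → v ≤ M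
bound τ zero    = 0 , λ _ ()
bound τ (suc n) with bound τ n
... | M , ok = M ⊔ encode (τ n) , go
  where
  go : ∀ j → j < suc n → ∀ {v} → τ j ≡ just v → v ≤ M ⊔ encode (τ n)
  go j (s≤s j≤n) {v} eq with m≤n⇒m<n∨m≡n j≤n
  ... | inj₁ j<n  = ≤-trans (ok j j<n eq) (m≤m⊔n M _)
  ... | inj₂ refl rewrite eq = ≤-trans (n≤1+n v) (m≤n⊔m M (suc v))

-- While the engine walks through the probes G b k, the bound b grows past the
-- history M seen so far; from then on the probe of kind k* can only be left for the goal.
module Climb {t : St} (P : Play t) (Goal : St → Set) (K M : ℕ) (k* : Kind) where
  open Play P

  -- Once `M ≤ b` the maximum is `b * 6`, just below the junk of `G b k`.
  Seen≤ : ℕ → ℕ → Set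
  Seen≤ n b = ∀ j → j < n → ∀ {v} → τ j ≡ just v → v ≤ M ⊔ b * 6

  Advance : ℕ → ℕ → Kind → Set
  Advance n b k = ∃[ b′ ] b ≤ b′ × s n ≡ next b′ k × Seen≤ n b′ × (k ≡ k* → b < M)

  Outcome : ℕ → ℕ → Kind → Set
  Outcome n b k = Advance n b k ⊎ Goal (s n)

  seen-suc : ∀ {n b} b′ → b ≤ b′ → Seen≤ n b → (∀ {v} → τ n ≡ just v → v ≤ M ⊔ b′ * 6) → Seen≤ (suc n) b′
  seen-suc {n} b′ b≤b′ seen new j (s≤s j≤n) eq with m≤n⇒m<n∨m≡n j≤n
  ... | inj₁ j<n  = ≤-trans (seen j j<n eq) (⊔-monoʳ-≤ M (*-monoˡ-≤ 6 b≤b′))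
  ... | inj₂ refl = new eq

  seen-⊔ : ∀ {n b} → Seen≤ n b → Seen≤ (suc n) (b ⊔ encode (τ n))
  seen-⊔ {n} {b} seen = seen-suc (b ⊔ encode (τ n)) (m≤m⊔n b _) seen new
    where
    new : ∀ {v} → τ n ≡ just v → v ≤ M ⊔ (b ⊔ encode (τ n)) * 6
    new {v} eq rewrite eq = begin
      v                       ≤⟨ n≤1+n v ⟩
      suc v                   ≤⟨ m≤n⊔m b (suc v) ⟩
      b ⊔ suc v               ≤⟨ m≤m*n (b ⊔ suc v) 6 ⟩
      (b ⊔ suc v) * 6         ≤⟨ m≤n⊔m M _ ⟩
      M ⊔ (b ⊔ suc v) * 6     ∎
      where open ≤-Reasoning

  module Proof
    (beacon : ℕ → Elt)
    (beacon∈ : ∀ b → mem t (beacon b) ≡ true)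
    (beacon> : ∀ b → M ⊔ b * 6 < value (beacon b))
    (once : ∀ n b k → K ≤ n → Seen≤ n b → s n ≡ G b k →
            Outcome (suc n) b k ⊎ (s (suc n) ≡ G b k × Seen≤ (suc n) b × τ n ≢ just (value (beacon b))))
    where

    -- The beacon exceeds everything seen, so it is still to come, and by `once` the engine cannot
    -- remain at `G b k` when it arrives.
    leave : ∀ n b k → K ≤ n → Seen≤ n b → s n ≡ G b k → ∃[ n′ ] K ≤ n′ × Outcome n′ b k
    leave n b k K≤n seen sn = wait (q ∸ n) n K≤n seen sn (m+[n∸m]≡n n≤q)
      where
      q : ℕ
      q = proj₁ (complete (beacon b) (beacon∈ b))
      n≤q : n ≤ q
      n≤q with n ≤? q
      ... | yes p = p
      ... | no  p = ⊥-elim (<⇒≱ (beacon> b) (seen q (≰⇒> p) (proj₂ (complete (beacon b) (beacon∈ b)))))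
      wait : ∀ d n → K ≤ n → Seen≤ n b → s n ≡ G b k → n + d ≡ q → ∃[ n′ ] K ≤ n′ × Outcome n′ b k
      wait d n K≤n seen sn eq with once n b k K≤n seen sn
      ... | inj₁ out = suc n , m≤n⇒m≤1+n K≤n , out
      wait zero    n K≤n seen sn eq | inj₂ (_ , _ , miss)
        = ⊥-elim (miss (trans (cong τ (trans (sym (+-identityʳ n)) eq)) (proj₂ (complete (beacon b) (beacon∈ b)))))
      wait (suc d) n K≤n seen sn eq | inj₂ (sn′ , seen′ , _)
        = wait d (suc n) (m≤n⇒m≤1+n K≤n) seen′ sn′ (trans (sym (+-suc n d)) eq)

    Reached : Set
    Reached = ∃[ n ] K ≤ n × Goal (s n)

    -- A round of three probes raises `b`, so `M ≤ b` holds when the fuel is used up; in such a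
    -- round the probe of kind `k*` cannot be left by an `Advance`.
    round : ∀ fuel n b → M ≤ fuel + b → K ≤ n → Seen≤ n b → s n ≡ G b (probe false) → Reached
    round fuel n b M≤ K≤n seen sn with leave n b _ K≤n seen sn
    ... | n₁ , K≤n₁ , inj₂ goal = n₁ , K≤n₁ , goal
    ... | n₁ , K≤n₁ , inj₁ (b₁ , b≤b₁ , s₁ , seen₁ , late₀) with leave n₁ b₁ _ K≤n₁ seen₁ s₁
    ...   | n₂ , K≤n₂ , inj₂ goal = n₂ , K≤n₂ , goal
    ...   | n₂ , K≤n₂ , inj₁ (b₂ , b₁≤b₂ , s₂ , seen₂ , late₁) with leave n₂ b₂ _ K≤n₂ seen₂ s₂
    ...     | n₃ , K≤n₃ , inj₂ goal = n₃ , K≤n₃ , goal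
    ...     | n₃ , K≤n₃ , inj₁ (b₃ , b₂≤b₃ , s₃ , seen₃ , late₂) = again fuel M≤
      where
      b≤b₃ : b ≤ b₃
      b≤b₃ = ≤-trans b≤b₁ (≤-trans b₁≤b₂ b₂≤b₃)
      again : ∀ fuel → M ≤ fuel + b → Reached
      again (suc fuel) M≤ = round fuel n₃ (suc b₃)
        (≤-trans M≤ (≤-trans (s≤s (+-monoʳ-≤ fuel b≤b₃)) (≤-reflexive (sym (+-suc fuel b₃)))))
        K≤n₃ (λ j j<n eq → ≤-trans (seen₃ j j<n eq) (⊔-monoʳ-≤ M (*-monoˡ-≤ 6 (n≤1+n b₃)))) s₃
      again zero M≤b = ⊥-elim (stuck k* refl)
        where
        stuck : ∀ k → k ≡ k* → ⊥
        stuck (probe false) eq = <⇒≱ (late₀ eq) M≤b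
        stuck (probe true)  eq = <⇒≱ (late₁ eq) (≤-trans M≤b b≤b₁)
        stuck pure          eq = <⇒≱ (late₂ eq) (≤-trans M≤b (≤-trans b≤b₁ b₁≤b₂))

    climb-pure : ∀ n b → K ≤ n → Seen≤ n b → s n ≡ G b pure → Reached
    climb-pure n b K≤n seen sn with leave n b _ K≤n seen sn
    ... | n₁ , K≤n₁ , inj₂ goal = n₁ , K≤n₁ , goal
    ... | n₁ , K≤n₁ , inj₁ (b₁ , _ , s₁ , seen₁ , _) = round M n₁ (suc b₁) (m≤m+n M (suc b₁)) K≤n₁
      (λ j j<n eq → ≤-trans (seen₁ j j<n eq) (⊔-monoʳ-≤ M (*-monoˡ-≤ 6 (n≤1+n b₁)))) s₁

    climb : ∀ n b k → K ≤ n → Seen≤ n b → s n ≡ G b k → Reached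
    climb n b (probe false) K≤n seen sn = round M n b (m≤m+n M b) K≤n seen sn
    climb n b pure          K≤n seen sn = climb-pure n b K≤n seen sn
    climb n b (probe true)  K≤n seen sn with leave n b _ K≤n seen sn
    ... | n₁ , K≤n₁ , inj₂ goal = n₁ , K≤n₁ , goal
    ... | n₁ , K≤n₁ , inj₁ (b₁ , _ , s₁ , seen₁ , _) = climb-pure n₁ b₁ K≤n₁ seen₁ s₁

M⊔b*6≤ : ∀ M b → M ⊔ b * 6 ≤ (M + b) * 6
M⊔b*6≤ M b = ⊔-lub (≤-trans (m≤m+n M b) (m≤m*n (M + b) 6)) (*-monoˡ-≤ 6 (m≤n+m b M))

M≤b⇒M⊔b*6≤ : ∀ {M b} → M ≤ b → M ⊔ b * 6 ≤ b * 6
M≤b⇒M⊔b*6≤ {M} {b} M≤b = ⊔-lub (≤-trans M≤b (m≤m*n b 6)) ≤-refl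

elt⇒value : ∀ {v x} → elt v ≡ x → v ≡ value x
elt⇒value {v} refl = sym (value-elt v)

step-G-cex : ∀ b k x e m → (∀ b′ k′ → e ≢ gee b′ k′) → move (G b k) x e (suc m) ≡ next (b ⊔ x) k
step-G-cex b (probe p) x (ord _)   m _ = refl
step-G-cex b (probe p) x (zed _)   m _ = refl
step-G-cex b (probe p) x (two _)   m _ = refl
step-G-cex b pure      x (ord _)   m _ = refl
step-G-cex b pure      x (zed _)   m _ = refl
step-G-cex b pure      x (two _)   m _ = refl
step-G-cex b k         x (gee b′ k′) m n = ⊥-elim (n b′ k′ refl)

hole*6≤12 : ∀ p → hole p * 6 ≤ 12
hole*6≤12 false = z≤n
hole*6≤12 true  = ≤-refl

none≢some : ∀ {v : ℕ} → nothing ≢ just v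
none≢some ()

-- Inverts `move`, so that claims about hypotheses `R u` can be proved by induction on time: where
-- the search is entered and where it continues.
into-R : ∀ s x e c {u} → move s x e c ≡ R u →
  (∃[ u₀ ] s ≡ R u₀ × (c ≡ 0 × u ≡ u₀ ⊎ c ≢ 0 × u ≡ pred u₀) × (∀ e′ → e ≡ ord e′ → shr e′ u₀ ≢ 0)) ⊎
  (∃[ b ] ∃[ a ] s ≡ G b pure × e ≡ zed a × c ≡ 0 × u ≡ full (2 + enc (G b pure)))
into-R (S q) x (ord _) zero    ()
into-R (S q) x (ord _) (suc _) ()
into-R (S q) x (zed _) zero    ()
into-R (S q) x (zed _) (suc _) ()
into-R (S q) x (two _) zero    ()
into-R (S q) x (two _) (suc _) ()
into-R (S q) x (gee _ _) c ()
into-R (R u₀) x (ord e) c eq with shr e u₀ in sh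
into-R (R u₀) x (ord e) c () | zero
into-R (R u₀) x (ord e) zero    refl | suc _ = inj₁ (u₀ , refl , inj₁ (refl , refl) , λ { _ refl z → 1+n≢0 (trans (sym sh) z) })
into-R (R u₀) x (ord e) (suc _) refl | suc _ = inj₁ (u₀ , refl , inj₂ ((λ ()) , refl) , λ { _ refl z → 1+n≢0 (trans (sym sh) z) })
into-R (R u₀) x (zed _) zero    refl = inj₁ (u₀ , refl , inj₁ (refl , refl) , λ _ ())
into-R (R u₀) x (zed _) (suc _) refl = inj₁ (u₀ , refl , inj₂ ((λ ()) , refl) , λ _ ())
into-R (R u₀) x (two _) zero    refl = inj₁ (u₀ , refl , inj₁ (refl , refl) , λ _ ())
into-R (R u₀) x (two _) (suc _) refl = inj₁ (u₀ , refl , inj₂ ((λ ()) , refl) , λ _ ())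
into-R (R u₀) x (gee _ _) c ()
into-R (G b k) x (gee _ _) c ()
into-R (G b (probe q)) x (ord e) zero eq with e ∸ b
into-R (G b (probe q)) x (ord e) zero () | zero
into-R (G b (probe q)) x (ord e) zero () | suc _
into-R (G b (probe false)) x (ord e) (suc _) ()
into-R (G b (probe true))  x (ord e) (suc _) ()
into-R (G b (probe q)) x (zed _) zero ()
into-R (G b (probe false)) x (zed _) (suc _) ()
into-R (G b (probe true))  x (zed _) (suc _) ()
into-R (G b (probe q)) x (two _) zero ()
into-R (G b (probe false)) x (two _) (suc _) ()
into-R (G b (probe true))  x (two _) (suc _) ()
into-R (G b pure) x (ord e) zero eq with e ∸ b
into-R (G b pure) x (ord e) zero () | zero
into-R (G b pure) x (ord e) zero () | suc _
into-R (G b pure) x (ord e) (suc _) ()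
into-R (G b pure) x (zed a) zero refl = inj₂ (b , a , refl , refl , refl , refl)
into-R (G b pure) x (zed _) (suc _) ()
into-R (G b pure) x (two _) zero ()
into-R (G b pure) x (two _) (suc _) ()

encode-0 : ∀ {x} → encode x ≡ 0 → x ≡ nothing
encode-0 {nothing} _ = refl

encode-≢0 : ∀ {x} → encode x ≢ 0 → ∃[ v ] x ≡ just v
encode-≢0 {nothing} ≢0 = ⊥-elim (≢0 refl)
encode-≢0 {just v}  _  = v , refl

-- Targets `S p`

module Target-S {p : Bool} (P : Play (S p)) where
  open Play P

  data Datum (n : ℕ) : Set where
    none : τ n ≡ nothing → Datum n
    some : ∀ e → τ n ≡ just (e * 6) → Datum n

  datum : ∀ n → Datum n
  datum n with τ n in τn
  ... | nothing = none τn
  ... | just v with elt v in ev | sound n τn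
  ...   | ord e | _ = some e (trans τn (cong just (elt⇒value ev)))

  observed≢gee : ∀ n b k → observed (τ n) ≢ gee b k
  observed≢gee n b k eq with datum n
  ... | none τn   rewrite τn with () ← eq
  ... | some e τn rewrite τn with () ← trans (sym (elt-value (ord e))) eq

  none-step : ∀ n {s′ c} → τ n ≡ nothing → s n ≡ s′ → cex n ≡ c → s (suc n) ≡ move s′ 0 (two 0) (encode c)
  none-step n τn sn cn = step-at P n sn τn cn

  some-step : ∀ n {s′ c} e → τ n ≡ just (e * 6) → s n ≡ s′ → cex n ≡ c →
              s (suc n) ≡ move s′ (suc (e * 6)) (ord e) (encode c)
  some-step n {s′} {c} e τn sn cn = trans (step-at P n sn τn cn)
    (cong (λ x → move s′ (suc (e * 6)) x (encode c)) (elt-value (ord e)))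

  stable : ∀ n → s n ≡ S p → s (suc n) ≡ S p
  stable n sn with datum n
  ... | none τn   = none-step n τn sn (cex-nothing P n sn)
  ... | some e τn = some-step n e τn sn (cex-nothing P n sn)

  -- The search for an `R` is entered at a `zed` only, and `S p` has none.
  notR : ∀ n u → s n ≢ R u
  notR zero    u eq with () ← trans (sym s-zero) eq
  notR (suc n) u eq with into-R (s n) _ (observed (τ n)) (encode (cex n)) (trans (sym (s-suc n)) eq)
  ... | inj₁ (u₀ , sn , _) = notR n u₀ sn
  ... | inj₂ (_ , a , _ , obs , _) with datum n
  ...   | none τn   rewrite τn with () ← obs
  ...   | some e τn rewrite τn with () ← trans (sym (elt-value (ord e))) obs

  -- `ord 4`, of value 24, is in both languages `S`. Once it has been shown, the holes, of values 0
  -- and 12, and the junk of the first probes lie below the history.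
  seen4 : ∃[ j ] τ j ≡ just 24
  seen4 = complete (ord 4) (even∈S p 0)

  K : ℕ
  K = suc (proj₁ seen4)

  refutes : ∀ n x → K ≤ n → mem (s n) x ≡ true → mem (S p) x ≡ false → value x < 24 → ∃[ m ] cex n ≡ just m
  refutes n x K≤n in-s out small with cex n in eq
  ... | just m  = m , refl
  ... | nothing = ⊥-elim (<⇒≱ small (quiet n eq x in-s out (proj₁ seen4) K≤n (proj₂ seen4)))

  M : ℕ
  -- One step beyond `K`, because a wrong `S q` held at time `K` is left for `start` only at
  -- `suc K`.
  M = proj₁ (bound τ (suc K))

  open Climb P (_≡ S p) K M (probe p)

  seen₀ : ∀ n b → n ≤ suc K → Seen≤ n b
  seen₀ n b n≤ j j<n eq = ≤-trans (proj₂ (bound τ (suc K)) j (<-≤-trans j<n n≤) eq) (m≤m⊔n M _)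

  beacon : ℕ → Elt
  beacon b = ord ((2 + (M + b)) + (2 + (M + b)))

  beacon> : ∀ b → M ⊔ b * 6 < value (beacon b)
  beacon> b = ≤-<-trans (M⊔b*6≤ M b) (*-monoˡ-< 6 (s≤s (≤-trans (n≤1+n _) (m≤m+n (suc (M + b)) (2 + (M + b))))))

  beacon>b : ∀ b → b < (2 + (M + b)) + (2 + (M + b))
  beacon>b b = s≤s (≤-trans (m≤n+m b M) (≤-trans (n≤1+n _) (m≤m+n (suc (M + b)) (2 + (M + b)))))

  -- For `M ≤ b` the probe has no visible error: its numbers belong to `S p` and its junk lies above
  -- all data.
  late : ∀ n b k {m} → Seen≤ n b → s n ≡ G b k → cex n ≡ just m → k ≡ probe p → b < M
  late n b k {m} seen sn cn refl with b <? M
  ... | yes b<M = b<M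
  ... | no  b≮M with in-s , out , j , j<n , v , τj , m<v ← refuted n cn
                with elt m in em | subst (λ s′ → mem s′ (elt m) ≡ true) sn in-s
  ...   | ord e      | e∈ = ⊥-elim (true≢false (trans (sym (proj₂ (∧-true {e ≤ᵇ b} e∈))) out))
  ...   | gee b′ k′  | g∈ with refl ← gee∈G⇒≡ b (probe p) b′ k′ g∈
    = ⊥-elim (<⇒≱ m<v (≤-trans (seen j j<n τj) (≤-trans (M≤b⇒M⊔b*6≤ (≮⇒≥ b≮M))
        (subst (b * 6 ≤_) (sym (elt⇒value em)) (m≤n+m (b * 6) (kind# (probe p)))))))

  -- A probe reaching the hole of `p` is refuted by it; otherwise `b` is so small that the junk of
  -- the probe lies below 24.
  probe-refuted : ∀ n b q → K ≤ n → q ≢ p → s n ≡ G b (probe q) → ∃[ m ] cex n ≡ just m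
  probe-refuted n b q K≤n q≢p sn with hole p ≤? b
  ... | yes h≤b = refutes n (ord (hole p)) K≤n
        (trans (cong (λ s′ → mem s′ (ord (hole p))) sn) (subst (λ c → c ∧ _ ≡ true) (sym (true-≤ᵇ h≤b)) (inS-hole q p q≢p)))
        (hole∉S p) (≤-<-trans (hole*6≤12 p) (m≤m+n 13 11))
  ... | no  h≰b = refutes n (gee b (probe q)) K≤n
        (trans (cong (λ s′ → mem s′ (gee b (probe q))) sn) (gee∈G b (probe q))) refl
        (≤-<-trans (+-mono-≤ (kind#≤ q) (*-monoˡ-≤ 6 (<⇒≤ (≰⇒> h≰b)))) (≤-<-trans (+-monoʳ-≤ 4 (hole*6≤12 p)) (m≤m+n 17 7)))
    where
    kind#≤ : ∀ q → kind# (probe q) ≤ 4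
    kind#≤ false = n≤1+n 3
    kind#≤ true  = ≤-refl

  small : ∀ n b e → Seen≤ n b → τ n ≡ just (e * 6) → e ≤ b → Seen≤ (suc n) b × τ n ≢ just (value (beacon b))
  small n b e seen τn e≤b =
    seen-suc b ≤-refl seen (λ eq → subst (_≤ _) (just-injective (trans (sym τn) eq)) (≤-trans (*-monoˡ-≤ 6 e≤b) (m≤n⊔m M _))) ,
    λ eq → <⇒≱ (beacon>b b) (subst (_≤ b) (*-cancelʳ-≡ e _ 6 (just-injective (trans (sym τn) eq))) e≤b)

  once : ∀ n b k → K ≤ n → Seen≤ n b → s n ≡ G b k →
         Outcome (suc n) b k ⊎ (s (suc n) ≡ G b k × Seen≤ (suc n) b × τ n ≢ just (value (beacon b)))
  once n b k K≤n seen sn with cex n in cn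
  ... | just m = inj₁ (inj₁ (b ⊔ encode (τ n) , m≤m⊔n b _ ,
          trans (step-at P n sn refl cn) (step-G-cex b k _ _ m (observed≢gee n)) , seen-⊔ {n} {b} seen , late n b k seen sn cn))
  ... | nothing with datum n
  ...   | none τn = inj₂ (trans (none-step n τn sn cn) (G-silent b k) ,
          seen-suc b ≤-refl seen (λ eq → ⊥-elim (none≢some (trans (sym τn) eq))) , λ eq → none≢some (trans (sym τn) eq))
  ...   | some e τn with k | e ∸ b in e∸b
  ...     | probe q | zero = inj₂ (trans (some-step n e τn sn cn) (cong (λ d → pick d (G b (probe q)) (S q)) e∸b) , small n b e seen τn (m∸n≡0⇒m≤n e∸b))
  ...     | pure | zero = inj₂ (trans (some-step n e τn sn cn) (cong (λ d → pick d (G b pure) (next (b ⊔ suc (e * 6)) pure)) e∸b) , small n b e seen τn (m∸n≡0⇒m≤n e∸b))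
  ...     | pure | suc d = inj₁ (inj₁ (b ⊔ encode (τ n) , m≤m⊔n b _ ,
            trans (some-step n e τn sn cn) (trans (cong (λ d → pick d (G b pure) (next (b ⊔ suc (e * 6)) pure)) e∸b) (cong (λ x → next (b ⊔ encode x) pure) (sym τn))) ,
            seen-⊔ {n} {b} seen , λ ()))
  ...     | probe q | suc d with q ≟ᵇ p
  ...       | yes refl = inj₁ (inj₂ (trans (some-step n e τn sn cn) (cong (λ d → pick d (G b (probe p)) (S p)) e∸b)))
  ...       | no q≢p with _ , eq ← probe-refuted n b q K≤n q≢p sn with () ← trans (sym cn) eq

  open Proof beacon (λ b → even∈S p (M + b)) beacon> once

  converges : ∃[ N ] ∀ n → N ≤ n → s n ≡ S p
  converges with s K in sK | notR K
  ... | R u   | nr = ⊥-elim (nr u refl)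
  ... | G b k | _  = let n , _ , sn = climb K b k ≤-refl (seen₀ K b (n≤1+n K)) sK in n , stays P stable sn
  ... | S q   | _ with q ≟ᵇ p
  ...   | yes refl = K , stays P stable sK
  ...   | no q≢p = let n , _ , sn = climb (suc K) 0 (probe false) (n≤1+n K) (seen₀ (suc K) 0 ≤-refl) restart in n , stays P stable sn
    where
    restart : s (suc K) ≡ start
    restart with m , cn ← refutes K (ord (hole p)) ≤-refl (trans (cong (λ s′ → mem s′ (ord (hole p))) sK) (inS-hole q p q≢p))
                            (hole∉S p) (≤-<-trans (hole*6≤12 p) (m≤m+n 13 11))
            with datum K
    ... | none τn   = none-step K τn sK cn
    ... | some e τn = some-step K e τn sK cn

-- Targets `R t`

module Target-R {t : ℕ} (P : Play (R t)) where
  open Play P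

  data Datum (n : ℕ) : Set where
    none  : τ n ≡ nothing → Datum n
    some  : ∀ e → bit e t ≡ true → τ n ≡ just (e * 6) → Datum n
    more  : ∀ a → τ n ≡ just (1 + a * 6) → Datum n
    stars : τ n ≡ just 2 → Datum n

  datum : ∀ n → Datum n
  datum n with τ n in τn
  ... | nothing = none τn
  ... | just v with elt v in ev | sound n τn
  ...   | ord e | e∈ = some e e∈ (trans τn (cong just (elt⇒value ev)))
  ...   | zed a | _  = more a (trans τn (cong just (elt⇒value ev)))
  ...   | two a | a∈ with refl ← ≡ᵇ-true a 0 (proj₁ (∧-true {a ≡ᵇ 0} a∈)) = stars (trans τn (cong just (elt⇒value ev)))

  observed-just : ∀ n x → τ n ≡ just (value x) → observed (τ n) ≡ x
  observed-just n x τn = trans (cong observed τn) (elt-value x)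

  observed≢gee : ∀ n b k → observed (τ n) ≢ gee b k
  observed≢gee n b k eq with datum n
  ... | none τn     with () ← trans (sym (cong observed τn)) eq
  ... | some e _ τn with () ← trans (sym (observed-just n (ord e) τn)) eq
  ... | more a τn   with () ← trans (sym (observed-just n (zed a) τn)) eq
  ... | stars τn    with () ← trans (sym (cong observed τn)) eq

  -- The search may have begun below `t`. Then some bit of `t` outside the range of `u` is still to
  -- be shown, and its arrival sends the engine back to `start`.
  Invariant : ℕ → ℕ → Set
  Invariant n u = t ≤ u ⊎ ∃[ e ] bit e t ≡ true × shr e u ≡ 0 × (∀ j → j < n → τ j ≢ just (e * 6))

  unseen-suc : ∀ {n e} → (∀ j → j < n → τ j ≢ just (e * 6)) → τ n ≢ just (e * 6) → ∀ j → j < suc n → τ j ≢ just (e * 6)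
  unseen-suc old new j (s≤s j≤n) with m≤n⇒m<n∨m≡n j≤n
  ... | inj₁ j<n  = old j j<n
  ... | inj₂ refl = new

  strict : ∀ n {u} → s n ≡ R u → (∃[ m ] cex n ≡ just m) → t ≤ u → t < u
  strict n sn (m , cn) t≤u with m≤n⇒m<n∨m≡n t≤u
  ... | inj₁ t<u  = t<u
  ... | inj₂ refl = ⊥-elim (no-refutation P n sn cn)

  invariant : ∀ n u → s n ≡ R u → Invariant n u
  invariant zero    u eq with () ← trans (sym s-zero) eq
  invariant (suc n) u eq with into-R (s n) _ (observed (τ n)) (encode (cex n)) (trans (sym (s-suc n)) eq)
  ... | inj₁ (u₀ , sn , how , in-range) with invariant n u₀ sn | how
  ...   | inj₁ t≤u₀ | inj₁ (_ , refl) = inj₁ t≤u₀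
  ...   | inj₁ t≤u₀ | inj₂ (c≢0 , refl) = inj₁ (<⇒≤pred (strict n sn (encode-≢0 c≢0) t≤u₀))
  ...   | inj₂ (e , e∈ , sh , unseen) | _ = inj₂ (e , e∈ , still how , unseen-suc {n} {e} unseen new)
    where
    new : τ n ≢ just (e * 6)
    new τn = in-range e (observed-just n (ord e) τn) sh
    still : (encode (cex n) ≡ 0 × u ≡ u₀ ⊎ encode (cex n) ≢ 0 × u ≡ pred u₀) → shr e u ≡ 0
    still (inj₁ (_ , refl)) = sh
    still (inj₂ (_ , refl)) = n≤0⇒n≡0 (subst (shr e (pred u₀) ≤_) sh (shr-mono e pred[n]≤n))
  invariant (suc n) u eq | inj₂ (b , a , sn , obs , c≡0 , refl) with shr (2 + enc (G b pure)) t ≟ 0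
  ...   | yes sh = inj₁ (≤full (2 + enc (G b pure)) t sh)
  ...   | no  sh with e , N≤e , e∈ ← high-bit (2 + enc (G b pure)) t sh
    = inj₂ (e , e∈ , shr-≥ (full (2 + enc (G b pure))) N≤e (shr-full (2 + enc (G b pure))) , unseen-suc {n} {e} old new)
    where
    -- Silence about the pure probe puts all earlier data at or below its junk, whose value is
    -- `enc (G b pure)`, and `e` exceeds that number.
    old : ∀ j → j < n → τ j ≢ just (e * 6)
    old j j<n τj = <⇒≱ (<-≤-trans (n<1+n _) (≤-trans (n≤1+n _) (≤-trans N≤e (m≤m*n e 6))))
      (quiet n (encode-0 c≡0) (gee b pure) (trans (cong (λ s′ → mem s′ (gee b pure)) sn) (gee∈G b pure)) refl j j<n τj)
    new : τ n ≢ just (e * 6)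
    new τn with () ← trans (sym (observed-just n (ord e) τn)) obs

  all-seen : ∀ B → ∃[ K ] ∀ e → e < B → bit e t ≡ true → ∃[ j ] j < K × τ j ≡ just (e * 6)
  all-seen zero = 0 , λ _ ()
  all-seen (suc B) with all-seen B | bit B t in b
  ... | K , ok | false = K , λ e e<B e∈ → ok e (≤∧≢⇒< (s≤s⁻¹ e<B) λ { refl → true≢false (trans (sym e∈) b) }) e∈
  ... | K , ok | true with j , τj ← complete (ord B) b = K ⊔ suc j , go
    where
    go : ∀ e → e < suc B → bit e t ≡ true → ∃[ j′ ] j′ < K ⊔ suc j × τ j′ ≡ just (e * 6)
    go e (s≤s e≤B) e∈ with m≤n⇒m<n∨m≡n e≤B
    ... | inj₁ e<B  = let j′ , j′<K , τj′ = ok e e<B e∈ in j′ , ≤-trans j′<K (m≤m⊔n K (suc j)) , τj′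
    ... | inj₂ refl = j , m≤n⊔m K (suc j) , τj

  -- Even and at least 4, hence in both languages `S`, and beyond all bits of `t`. Since `zed gap`
  -- comes right after `ord gap`, showing it makes this error visible.
  gap : ℕ
  gap = (2 + t) + (2 + t)

  t≤gap : t ≤ gap
  t≤gap = ≤-trans (m≤n+m t 2) (m≤m+n (2 + t) (2 + t))

  K : ℕ
  K = proj₁ (all-seen t) ⊔ suc (proj₁ (complete (zed gap) refl))

  settled : ∀ n u → K ≤ n → s n ≡ R u → t ≤ u
  settled n u K≤n sn with invariant n u sn
  ... | inj₁ t≤u = t≤u
  ... | inj₂ (e , e∈ , _ , unseen) with j , j<K , τj ← proj₂ (all-seen t) e (bit⇒< e∈) e∈
    = ⊥-elim (unseen j (<-≤-trans j<K (≤-trans (m≤m⊔n _ _) K≤n)) τj)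

  refutes : ∀ n x → K ≤ n → mem (s n) x ≡ true → mem (R t) x ≡ false → value x ≤ gap * 6 → ∃[ m ] cex n ≡ just m
  refutes n x K≤n in-s out small with cex n in eq
  ... | just m  = m , refl
  ... | nothing = ⊥-elim (<⇒≱ (s≤s small) (quiet n eq x in-s out _ (≤-trans (m≤n⊔m (proj₁ (all-seen t)) _) K≤n) (proj₂ (complete (zed gap) refl))))

  M : ℕ
  -- The 2 covers the datum `two 0`; the `t` ensures that no bit of `t` drives the engine away from
  -- a pure probe with `M ≤ b`.
  M = proj₁ (bound τ (suc K)) ⊔ (2 + t)

  open Climb P (λ s′ → ∃[ u ] s′ ≡ R u) K M pure

  seen₀ : ∀ n b → n ≤ suc K → Seen≤ n b
  seen₀ n b n≤ j j<n eq = ≤-trans (proj₂ (bound τ (suc K)) j (<-≤-trans j<n n≤) eq) (≤-trans (m≤m⊔n _ _) (m≤m⊔n M _))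

  2+t≤M : 2 + t ≤ M
  2+t≤M = m≤n⊔m (proj₁ (bound τ (suc K))) (2 + t)

  beacon : ℕ → Elt
  beacon b = zed (M + b)

  late : ∀ n b k {m} → Seen≤ n b → s n ≡ G b k → cex n ≡ just m → k ≡ pure → b < M
  late n b k {m} seen sn cn refl with b <? M
  ... | yes b<M = b<M
  ... | no  b≮M with in-s , out , j , j<n , v , τj , m<v ← refuted n cn
                with elt m in em | subst (λ s′ → mem s′ (elt m) ≡ true) sn in-s
  ...   | gee b′ k′  | g∈ with refl ← gee∈G⇒≡ b pure b′ k′ g∈
    = ⊥-elim (<⇒≱ m<v (≤-trans (seen j j<n τj) (≤-trans (M≤b⇒M⊔b*6≤ (≮⇒≥ b≮M))
        (subst (b * 6 ≤_) (sym (elt⇒value em)) (m≤n+m (b * 6) 5)))))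

  probe-refuted : ∀ n b q → K ≤ n → s n ≡ G b (probe q) → ∃[ m ] cex n ≡ just m
  probe-refuted n b q K≤n sn with gap ≤? b
  ... | yes g≤b = refutes n (ord gap) K≤n
        (trans (cong (λ s′ → mem s′ (ord gap)) sn) (subst (λ c → c ∧ inS q gap ≡ true) (sym (true-≤ᵇ g≤b)) (even∈S q t)))
        (bit-large t≤gap) ≤-refl
  ... | no  g≰b = refutes n (gee b (probe q)) K≤n
        (trans (cong (λ s′ → mem s′ (gee b (probe q))) sn) (gee∈G b (probe q))) refl
        (≤-trans (+-monoˡ-≤ (b * 6) (kind#≤ q)) (*-monoˡ-≤ 6 (≰⇒> g≰b)))
    where
    kind#≤ : ∀ q → kind# (probe q) ≤ 6
    kind#≤ false = m≤m+n 3 3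
    kind#≤ true  = m≤m+n 4 2

  once : ∀ n b k → K ≤ n → Seen≤ n b → s n ≡ G b k →
         Outcome (suc n) b k ⊎ (s (suc n) ≡ G b k × Seen≤ (suc n) b × τ n ≢ just (value (beacon b)))
  once n b k K≤n seen sn with cex n in cn
  ... | just m = inj₁ (inj₁ (b ⊔ encode (τ n) , m≤m⊔n b _ ,
          trans (step-at P n sn refl cn) (step-G-cex b k _ _ m (observed≢gee n)) , seen-⊔ {n} {b} seen , late n b k seen sn cn))
  once n b (probe q) K≤n seen sn | nothing with _ , eq ← probe-refuted n b q K≤n sn with () ← trans (sym cn) eq
  once n b pure K≤n seen sn | nothing with datum n
  ... | none τn = inj₂ (step-at P n sn τn cn ,
          seen-suc b ≤-refl seen (λ eq → ⊥-elim (none≢some (trans (sym τn) eq))) , λ eq → none≢some (trans (sym τn) eq))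
  ... | stars τn = inj₂ (step-at P n sn τn cn ,
          seen-suc b ≤-refl seen (λ eq → subst (_≤ _) (just-injective (trans (sym τn) eq)) (≤-trans (≤-trans (m≤m+n 2 t) 2+t≤M) (m≤m⊔n M _))) ,
          λ eq → distinct (trans (sym τn) eq))
    where
    distinct : just 2 ≢ just (value (beacon b))
    distinct eq with () ← trans (cong observed eq) (elt-value (beacon b))
  ... | more a τn = inj₁ (inj₂ (_ , trans (step-at P n sn τn cn) (cong (λ x → move (G b pure) (2 + a * 6) x 0) (elt-value (zed a)))))
  ... | some e e∈ τn with e ∸ b in e∸b
  ...   | zero = inj₂ (trans (step-at P n sn τn cn) (trans (cong (λ x → move (G b pure) (suc (e * 6)) x 0) (elt-value (ord e)))
                         (cong (λ d → pick d (G b pure) (next (b ⊔ suc (e * 6)) pure)) e∸b)) ,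
          seen-suc b ≤-refl seen (λ eq → subst (_≤ _) (just-injective (trans (sym τn) eq)) (≤-trans (*-monoˡ-≤ 6 (m∸n≡0⇒m≤n {e} {b} e∸b)) (m≤n⊔m M _))) ,
          λ eq → distinct (trans (sym τn) eq))
    where
    distinct : just (e * 6) ≢ just (value (beacon b))
    distinct eq with () ← trans (sym (elt-value (ord e))) (trans (cong observed eq) (elt-value (beacon b)))
  ...   | suc d = inj₁ (inj₁ (b ⊔ encode (τ n) , m≤m⊔n b _ ,
          trans (step-at P n sn τn cn) (trans (cong (λ x → move (G b pure) (suc (e * 6)) x 0) (elt-value (ord e)))
            (trans (cong (λ d → pick d (G b pure) (next (b ⊔ suc (e * 6)) pure)) e∸b) (cong (λ x → next (b ⊔ encode x) pure) (sym τn)))) ,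
          seen-⊔ {n} {b} seen ,
          λ _ → <-≤-trans (m∸n≢0⇒n<m λ z → 1+n≢0 (trans (sym e∸b) z)) (≤-trans (<⇒≤ (bit⇒< e∈)) (≤-trans (m≤n+m t 2) 2+t≤M))))

  open Proof beacon (λ _ → refl) (λ b → s≤s (M⊔b*6≤ M b)) once

  -- For `t ≤ u` every bit of `t` is in the range of `u`, so no datum restarts the search.
  R-step : ∀ n u → t ≤ u → s n ≡ R u → s (suc n) ≡ pick (encode (cex n)) (R u) (R (pred u))
  R-step n u t≤u sn with datum n
  ... | none τn   = step-at P n sn τn refl
  ... | stars τn  = step-at P n sn τn refl
  ... | more a τn = trans (step-at P n sn τn refl) (cong (λ x → move (R u) (2 + a * 6) x (encode (cex n))) (elt-value (zed a)))
  ... | some e e∈ τn = trans (step-at P n sn τn refl) (trans (cong (λ x → move (R u) (suc (e * 6)) x (encode (cex n))) (elt-value (ord e)))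
                         (in-range (shr e u) λ z → bit⇒shr≢0 e e∈ (n≤0⇒n≡0 (subst (shr e t ≤_) z (shr-mono e t≤u)))))
    where
    in-range : ∀ {A : Set} {a b : A} d → d ≢ 0 → pick d a b ≡ b
    in-range zero    ≢0 = ⊥-elim (≢0 refl)
    in-range (suc d) _  = refl

  stable : ∀ n → s n ≡ R t → s (suc n) ≡ R t
  stable n sn = trans (R-step n t ≤-refl sn) (cong (λ c → pick (encode c) (R t) (R (pred t))) (cex-nothing P n sn))

  -- For `t < u` some bit `e` of `u` is missing from `t`. After `zed e` has been shown, `ord e` is a
  -- visible error, so `R u` is refuted and lowered; by `settled` it never drops below `t`.
  shrink : ∀ u → (∀ {u′} → u′ < u → ∀ n → K ≤ n → s n ≡ R u′ → ∃[ N ] s N ≡ R t) →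
           ∀ n → K ≤ n → s n ≡ R u → ∃[ N ] s N ≡ R t
  shrink u rec n K≤n sn with m≤n⇒m<n∨m≡n (settled n u K≤n sn)
  ... | inj₂ refl = n , sn
  ... | inj₁ t<u with e , e∈u , e∉t ← ⊈-smaller t u t<u with j , τj ← complete (zed e) refl = wait (suc j) n K≤n sn (m≤n+m (suc j) n)
    where
    u≢0 : u ≢ 0
    u≢0 refl = n≮0 t<u
    pred< : pred u < u
    pred< = ≤-reflexive (suc-pred u ⦃ ≢-nonZero u≢0 ⦄)
    wait : ∀ d n → K ≤ n → s n ≡ R u → suc j ≤ n + d → ∃[ N ] s N ≡ R t
    wait d n K≤n sn j<n+d with cex n in cn
    ... | just m = rec pred< (suc n) (m≤n⇒m≤1+n K≤n) (trans (R-step n u (<⇒≤ t<u) sn) (cong (λ c → pick (encode c) (R u) (R (pred u))) cn))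
    wait zero n K≤n sn j<n+d | nothing = ⊥-elim (1+n≰n
      (quiet n cn (ord e) (trans (cong (λ s′ → mem s′ (ord e)) sn) e∈u) e∉t j (subst (suc j ≤_) (+-identityʳ n) j<n+d) τj))
    wait (suc d) n K≤n sn j<n+d | nothing = wait d (suc n) (m≤n⇒m≤1+n K≤n)
      (trans (R-step n u (<⇒≤ t<u) sn) (cong (λ c → pick (encode c) (R u) (R (pred u))) cn)) (subst (suc j ≤_) (+-suc n d) j<n+d)

  from-R : ∀ u n → K ≤ n → s n ≡ R u → ∃[ N ] ∀ m → N ≤ m → s m ≡ R t
  from-R u n K≤n sn with N , sN ← <-rec (λ u → ∀ n → K ≤ n → s n ≡ R u → ∃[ N ] s N ≡ R t) shrink u n K≤n sn = N , stays P stable sN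

  converges : ∃[ N ] ∀ n → N ≤ n → s n ≡ R t
  converges with s K in sK
  ... | R u   = from-R u K ≤-refl sK
  ... | G b k = let n , K≤n , u , sn = climb K b k ≤-refl (seen₀ K b (n≤1+n K)) sK in from-R u n K≤n sn
  ... | S q   = let n , K≤n , u , sn = climb (suc K) 0 (probe false) (n≤1+n K) (seen₀ (suc K) 0 ≤-refl) restart in from-R u n K≤n sn
    where
    S-cex : ∀ x e m → (∀ b′ k′ → e ≢ gee b′ k′) → move (S q) x e (suc m) ≡ start
    S-cex x (ord _)   m _ = refl
    S-cex x (zed _)   m _ = refl
    S-cex x (two _)   m _ = refl
    S-cex x (gee b k) m n = ⊥-elim (n b k refl)
    restart : s (suc K) ≡ start
    restart with m , cn ← refutes K (ord gap) ≤-refl (trans (cong (λ s′ → mem s′ (ord gap)) sK) (even∈S q t)) (bit-large t≤gap) ≤-refl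
      = trans (step-at P K sK refl cn) (S-cex _ _ m (observed≢gee K))

converges : ∀ {t} (P : Play t) → ∃[ N ] ∀ n → N ≤ n → Play.s P n ≡ t
converges {S p}   P = Target-S.converges P
converges {R u}   P = Target-R.converges P
converges {G b k} P = Target-G.converges P

play : ∀ {i τ cex} → IsTrace (lang i) τ → IsCexSequence HCHECK engine (lang i) τ cex → Play (dec i)
play {i} {τ} {cex} (sound , complete) ok = record
  { τ        = τ
  ; cex      = cex
  ; s        = λ n → dec (Engine.T engine τ cex n)
  ; s-zero   = dec-enc start
  ; s-suc    = λ n → dec-enc _
  ; sound    = λ n τn → b2n-1 (sound (n , τn))
  ; complete = λ x x∈ → complete (cong b2n (trans (cong (mem (dec i)) (elt-value x)) x∈))
  ; quiet    = λ n cn x x∈ x∉ j j<n {v} τj → ≮⇒≥ λ x<v →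
      subst (HCHECK (lang i) _ τ n) cn (ok n) (value x
        , (λ x∈i → true≢false (trans (sym (b2n-1 x∈i)) (trans (cong (mem (dec i)) (elt-value x)) x∉)))
        , cong b2n (trans (cong (mem (dec (Engine.T engine τ cex n))) (elt-value x)) x∈)
        , j , j<n , v , τj , x<v)
  ; refuted  = λ n {m} cn → let m∉ , m∈ , below = subst (HCHECK (lang i) _ τ n) cn (ok n)
                            in b2n-1 m∈ , absent m∉ , below
  }
  where
  absent : ∀ {b} → b2n b ≢ 1 → b ≡ false
  absent {false} _  = refl
  absent {true}  ≢1 = ⊥-elim (≢1 refl)

hcegis : HCEGIS family
hcegis = engine , λ i τ cex tr ok →
  let N , conv = converges (play {i} tr ok) in N , λ n N≤n → dec≡⇒≈ {Engine.T engine τ cex n} {i} (conv n N≤n)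

-- The adversary against unrestricted counterexamples

-- The number with binary digits `f 0`, ..., `f (n - 1)`, lowest first.
mask : (ℕ → Bool) → ℕ → ℕ
mask f zero    = 0
mask f (suc n) = b2n (f 0) + (mask (f ∘ suc) n + mask (f ∘ suc) n)

half-mask : ∀ f n → half (mask f (suc n)) ≡ mask (f ∘ suc) n × odd (mask f (suc n)) ≡ f 0
half-mask f n with f 0
... | false = half-double (mask (f ∘ suc) n)
... | true  = half-suc-double (mask (f ∘ suc) n)

bit-mask : ∀ f n e → e < n → bit e (mask f n) ≡ f e
bit-mask f (suc n) zero    _         = proj₂ (half-mask f n)
bit-mask f (suc n) (suc e) (s≤s e<n) =
  trans (bit-suc e _) (trans (cong (bit e) (proj₁ (half-mask f n))) (bit-mask (f ∘ suc) n e e<n))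

bit-mask-≥ : ∀ f n e → n ≤ e → bit e (mask f n) ≡ false
bit-mask-≥ f zero    e       _         = cong odd (shr-zero e)
bit-mask-≥ f (suc n) (suc e) (s≤s n≤e) =
  trans (bit-suc e _) (trans (cong (bit e) (proj₁ (half-mask f n))) (bit-mask-≥ (f ∘ suc) n e n≤e))

bit-mask⇒ : ∀ f n e → bit e (mask f n) ≡ true → f e ≡ true
bit-mask⇒ f n e e∈ with e <? n
... | yes e<n = trans (sym (bit-mask f n e e<n)) e∈
... | no  e≮n with () ← trans (sym e∈) (bit-mask-≥ f n e (≮⇒≥ e≮n))

¬true : ∀ {b} → b ≢ true → b ≡ false
¬true {false} _  = refl
¬true {true}  ≢t = ⊥-elim (≢t refl)

odds≡0 : ∀ n u → odds n u ≡ 0 → ∀ k → k < n → bit (suc (k + k)) u ≡ false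
odds≡0 (suc n) u eq k (s≤s k≤n) with m≤n⇒m<n∨m≡n k≤n
... | inj₁ k<n  = odds≡0 n u (m+n≡0⇒m≡0 (odds n u) eq) k k<n
... | inj₂ refl with bit (suc (k + k)) u | m+n≡0⇒n≡0 (odds k u) eq
...   | false | _ = refl

odd⇒≡ : ∀ e → odd e ≡ true → e ≡ suc (half e + half e)
odd⇒≡ e oe = trans (odd+half e) (cong (λ b → b2n b + (half e + half e)) oe)

odd-bit⇒odds≢0 : ∀ e u → odd e ≡ true → bit e u ≡ true → odds u u ≢ 0
odd-bit⇒odds≢0 e u oe e∈ eq = true≢false (trans (sym (subst (λ e → bit e u ≡ true) (odd⇒≡ e oe) e∈))
  (odds≡0 u u eq (half e) (<-trans (subst (half e <_) (sym (odd⇒≡ e oe)) (s≤s (m≤m+n _ _))) (bit⇒< e∈))))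

odd-bit : ℕ → ℕ → Maybe ℕ
odd-bit zero    u = nothing
odd-bit (suc n) u = if bit (suc (n + n)) u then just (suc (n + n)) else odd-bit n u

odd-bit-just : ∀ n u {e} → odd-bit n u ≡ just e → bit e u ≡ true × odd e ≡ true
odd-bit-just (suc n) u eq with bit (suc (n + n)) u in b
odd-bit-just (suc n) u refl | true = b , proj₂ (half-suc-double n)
odd-bit-just (suc n) u eq   | false = odd-bit-just n u eq

odd-bit-nothing : ∀ n u → odd-bit n u ≡ nothing → odds n u ≡ 0
odd-bit-nothing zero    u _ = refl
odd-bit-nothing (suc n) u eq with bit (suc (n + n)) u
... | false = trans (+-identityʳ _) (odd-bit-nothing n u eq)

-- A member of `R u` outside both languages `S`; `two 0` belongs to `R u` exactly when there is no
-- odd bit to choose.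
junk : ℕ → Elt
junk u with odd-bit u u
... | just e  = ord e
... | nothing = two 0

junk∈ : ∀ u → mem (R u) (junk u) ≡ true
junk∈ u with odd-bit u u in eq
... | just e  = proj₁ (odd-bit-just u u eq)
... | nothing rewrite odd-bit-nothing u u eq = refl

extra-bit : ℕ → ℕ → ℕ → Maybe ℕ
extra-bit zero    u t = nothing
extra-bit (suc n) u t = if bit n u ∧ not (bit n t) then just n else extra-bit n u t

extra-bit-just : ∀ n u t {e} → extra-bit n u t ≡ just e → bit e u ≡ true × bit e t ≡ false
extra-bit-just (suc n) u t eq with bit n u in bu | bit n t in bt
extra-bit-just (suc n) u t refl | true  | false = bu , bt
extra-bit-just (suc n) u t eq   | true  | true  = extra-bit-just n u t eq
extra-bit-just (suc n) u t eq   | false | _     = extra-bit-just n u t eq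

extra-bit-nothing : ∀ n u t → extra-bit n u t ≡ nothing → ∀ e → e < n → bit e u ≡ true → bit e t ≡ true
extra-bit-nothing (suc n) u t eq e (s≤s e≤n) e∈ with bit n u in bu | bit n t in bt | m≤n⇒m<n∨m≡n e≤n
extra-bit-nothing (suc n) u t () e (s≤s e≤n) e∈ | true  | false | _
extra-bit-nothing (suc n) u t eq e (s≤s e≤n) e∈ | true  | true  | inj₁ e<n  = extra-bit-nothing n u t eq e e<n e∈
extra-bit-nothing (suc n) u t eq e (s≤s e≤n) e∈ | true  | true  | inj₂ refl = bt
extra-bit-nothing (suc n) u t eq e (s≤s e≤n) e∈ | false | _     | inj₁ e<n  = extra-bit-nothing n u t eq e e<n e∈
extra-bit-nothing (suc n) u t eq e (s≤s e≤n) e∈ | false | _     | inj₂ refl with () ← trans (sym bu) e∈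

-- Answers that are correct for several targets

Valid : St → St → Maybe ℕ → Set
Valid t s nothing  = ∀ x → mem s x ≡ true → mem t x ≡ true
Valid t s (just v) = mem s (elt v) ≡ true × mem t (elt v) ≡ false

valid-value : ∀ {t s} x → mem s x ≡ true → mem t x ≡ false → Valid t s (just (value x))
valid-value {t} {s} x x∈ x∉ rewrite elt-value x = x∈ , x∉

answerS : Bool → St → Maybe ℕ
answerS p (S q) with q ≟ᵇ p
... | yes _ = nothing
... | no  _ = just (value (ord (hole p)))
answerS p (R u)   = just (value (junk u))
answerS p (G b k) = just (value (gee b k))

answerS-valid : ∀ p s → Valid (S p) s (answerS p s)
answerS-valid p (S q) with q ≟ᵇ p
... | yes refl = λ _ x∈ → x∈
... | no  q≢p  = valid-value {S p} {S q} (ord (hole p)) (inS-hole q p q≢p) (hole∉S p)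
answerS-valid p (R u) = valid-value {S p} {R u} (junk u) (junk∈ u) outside
  where
  outside : mem (S p) (junk u) ≡ false
  outside with odd-bit u u in eq
  ... | nothing = refl
  ... | just e rewrite proj₂ (odd-bit-just u u eq) = refl
answerS-valid p (G b k) = valid-value {S p} {G b k} (gee b k) (gee∈G b k) refl

-- The answers given for the target S p are correct for such an R t as well, as long
-- as l has not been used as a counterexample.
record Decoy (p : Bool) (t l : ℕ) : Set where
  field
    label-odd : odd l ≡ true
    label∈    : bit l t ≡ true
    only      : ∀ e → odd e ≡ true → bit e t ≡ true → e ≡ l
    hole∉     : bit (hole p) t ≡ false

-- The junk of an `R u` is odd or `two 0`. The only odd bit of `t` is the label, and its presence
-- keeps `two 0` out of `R t`.
answerS-decoy : ∀ {p t l} → Decoy p t l → ∀ s → s ≢ S p → answerS p s ≢ just (value (ord l)) → Valid (R t) s (answerS p s)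
answerS-decoy {p} D (S q) s≢ _ with q ≟ᵇ p
... | yes refl = ⊥-elim (s≢ refl)
... | no  q≢p  = valid-value {R _} {S q} (ord (hole p)) (inS-hole q p q≢p) (Decoy.hole∉ D)
answerS-decoy {p} {t} {l} D (R u) _ ≢l = valid-value {R t} {R u} (junk u) (junk∈ u) outside
  where
  outside : mem (R t) (junk u) ≡ false
  outside with odd-bit u u in eq
  ... | just e = ¬true λ e∈ → ≢l (cong (just ∘ value ∘ ord) (Decoy.only D e (proj₂ (odd-bit-just u u eq)) e∈))
  ... | nothing with odds t t in od
  ...   | zero  = ⊥-elim (odd-bit⇒odds≢0 l t (Decoy.label-odd D) (Decoy.label∈ D) od)
  ...   | suc _ = refl
answerS-decoy D (G b k) _ _ = valid-value {R _} {G b k} (gee b k) (gee∈G b k) refl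

-- Meant for `R t` and for a larger `R t′` alike. If `u` has no bit outside `t`, then `R u` is
-- contained in both when it has an odd bit, and otherwise errs at `two 0`.
answerR : Bool → ℕ → ℕ → St → Maybe ℕ
answerR p t m (S q) with q ≟ᵇ p
... | yes _ = just (value (ord m))
... | no  _ = just (value (ord (hole p)))
answerR p t m (G b k) = just (value (gee b k))
answerR p t m (R u) with extra-bit u u t | odd-bit u u
... | just e  | _       = just (value (ord e))
... | nothing | nothing = just (value (two 0))
... | nothing | just _  = nothing

answerR-valid : ∀ {p t t′ l m} → Decoy p t′ l → inS p m ≡ true → bit m t′ ≡ false → (∀ e → bit e t ≡ true → bit e t′ ≡ true) →
                ∀ s → (∀ u → s ≡ R u → ∀ e → bit e u ≡ true → bit e t ≡ false → bit e t′ ≡ false) → Valid (R t′) s (answerR p t m s)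
answerR-valid {p} {m = m} D m∈ m∉ _ (S q) _ with q ≟ᵇ p
... | yes refl = valid-value {R _} {S q} (ord m) m∈ m∉
... | no  q≢p  = valid-value {R _} {S q} (ord (hole p)) (inS-hole q p q≢p) (Decoy.hole∉ D)
answerR-valid D _ _ _ (G b k) _ = valid-value {R _} {G b k} (gee b k) (gee∈G b k) refl
answerR-valid {p} {t} {t′} {l} D _ _ t⊆t′ (R u) fresh with extra-bit u u t in ex | odd-bit u u in od
... | just e  | _ = let e∈ , e∉ = extra-bit-just u u t ex in valid-value {R t′} {R u} (ord e) e∈ (fresh u refl e e∈ e∉)
... | nothing | nothing = valid-value {R t′} {R u} (two 0) star∈ star∉
  where
  star∈ : mem (R u) (two 0) ≡ true
  star∈ rewrite odd-bit-nothing u u od = refl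
  star∉ : mem (R t′) (two 0) ≡ false
  star∉ with odds t′ t′ in eq
  ... | zero  = ⊥-elim (odd-bit⇒odds≢0 l t′ (Decoy.label-odd D) (Decoy.label∈ D) eq)
  ... | suc _ = refl
... | nothing | just o = included
  where
  included : ∀ x → mem (R u) x ≡ true → mem (R t′) x ≡ true
  included (ord e) e∈ = t⊆t′ e (extra-bit-nothing u u t ex e (bit⇒< e∈) e∈)
  included (zed _) _  = refl
  included (two a) a∈ with o∈ , oo ← odd-bit-just u u od =
    ⊥-elim (odd-bit⇒odds≢0 o u oo o∈ (≡ᵇ-true _ _ (proj₂ (∧-true {a ≡ᵇ 0} a∈))))

splice : ∀ {A : Set} → ℕ → (ℕ → A) → (ℕ → A) → ℕ → A
splice zero    f g n       = g n
splice (suc k) f g zero    = f zero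
splice (suc k) f g (suc n) = splice k (f ∘ suc) g n

splice-< : ∀ {A : Set} k (f g : ℕ → A) n → n < k → splice k f g n ≡ f n
splice-< (suc k) f g zero    _         = refl
splice-< (suc k) f g (suc n) (s≤s n<k) = splice-< k (f ∘ suc) g n n<k

splice-+ : ∀ {A : Set} k (f g : ℕ → A) n → splice k f g (k + n) ≡ g n
splice-+ zero    f g n = refl
splice-+ (suc k) f g n = splice-+ k (f ∘ suc) g n

data Split (k n : ℕ) : Set where
  before : n < k → Split k n
  after  : ∀ j → n ≡ k + j → Split k n

split : ∀ k n → Split k n
split k n with n <? k
... | yes n<k = before n<k
... | no  n≮k = after (n ∸ k) (sym (m+[n∸m]≡n (≮⇒≥ n≮k)))

canon : St → Sequence
canon s v = if mem s (elt v) then just v else nothing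

canon-sound : ∀ s n {v} → canon s n ≡ just v → n ≡ v × mem s (elt v) ≡ true
canon-sound s n eq with mem s (elt n) in n∈
canon-sound s n refl | true = refl , n∈

canon-complete : ∀ s x → mem s x ≡ true → canon s (value x) ≡ just (value x)
canon-complete s x x∈ rewrite elt-value x | x∈ = refl

first : ∀ {P : ℕ → Set} → (∀ n → Dec (P n)) → ∀ N → P N → ∃[ n ] P n × (∀ m → m < n → ¬ P m)
first {P} P? N pN = go N 0 (λ _ ()) (subst P (sym (+-identityʳ N)) pN)
  where
  go : ∀ d n → (∀ m → m < n → ¬ P m) → P (d + n) → ∃[ n ] P n × (∀ m → m < n → ¬ P m)
  go d n none pN with P? n
  ... | yes p = n , p , none
  go zero    n none pN | no ¬p = ⊥-elim (¬p pN)
  go (suc d) n none pN | no ¬p = go d (suc n) none′ (subst P (sym (+-suc d n)) pN)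
    where
    none′ : ∀ m → m < suc n → ¬ P m
    none′ m (s≤s m≤n) with m≤n⇒m<n∨m≡n m≤n
    ... | inj₁ m<n  = none m m<n
    ... | inj₂ refl = ¬p

_≟S_ : ∀ s p → Dec (s ≡ S p)
S q   ≟S p with q ≟ᵇ p
... | yes refl = yes refl
... | no  q≢p  = no λ { refl → q≢p refl }
R u   ≟S p = no λ ()
G b k ≟S p = no λ ()

value-ord≥ : ∀ {v e} → elt v ≡ ord e → e ≤ v
value-ord≥ {v} {e} ev = subst (e ≤_) (sym (elt⇒value ev)) (m≤m*n e 6)

∨-true : ∀ {a b} → a ∨ b ≡ true → a ≡ true ⊎ b ≡ true
∨-true {true}  _ = inj₁ refl
∨-true {false} b = inj₂ b

∨-introˡ : ∀ {a} b → a ≡ true → a ∨ b ≡ true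
∨-introˡ b refl = refl

∨-introʳ : ∀ a {b} → b ≡ true → a ∨ b ≡ true
∨-introʳ true  refl = refl
∨-introʳ false refl = refl

-- The adversary's play against a given engine

module Adversary (E : Engine family) (identifies : Identifies CHECK E) where
  open Engine E using (F; F-cong; initial; T)

  abstract
    -- Ensures that the first visit to `S p` is preceded by at least one datum.
    other-limit : ∃[ p ] dec initial ≢ S p
    other-limit with dec initial ≟S false
    ... | yes eq = true , λ eq′ → different (trans (sym eq) eq′)
      where
      different : S false ≢ S true
      different ()
    ... | no  ne = false , ne

  p : Bool
  p = proj₁ other-limit

  -- Answers depend on time and hypothesis alone, so that a run can be cut at a visit to `S p` and
  -- continued under other answers.
  Policy : Set
  Policy = ℕ → St → Maybe ℕ

  run : ℕ → Sequence → Policy → ℕ → ℕ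
  run i τ a zero    = i
  run i τ a (suc n) = run (F i (τ 0) (a 0 (dec i))) (τ ∘ suc) (a ∘ suc) n

  F-dec : ∀ {i j} x c → dec i ≡ dec j → dec (F i x c) ≡ dec (F j x c)
  F-dec {i} {j} x c eq = ≈⇒dec≡ {F i x c} {F j x c} (F-cong {i} {j} x c (dec≡⇒≈ {i} {j} eq))

  -- The hypothesis is the engine's whole memory: by `F-dec`, runs that meet in one language have
  -- the same future.
  run-dec : ∀ {i j} τ a n → dec i ≡ dec j → dec (run i τ a n) ≡ dec (run j τ a n)
  run-dec τ a zero eq = eq
  run-dec {i} {j} τ a (suc n) eq = run-dec (τ ∘ suc) (a ∘ suc) n
    (trans (F-dec {i} {j} (τ 0) (a 0 (dec i)) eq) (cong (λ s → dec (F j (τ 0) (a 0 s))) eq))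

  run-last : ∀ i τ a n → run i τ a (suc n) ≡ F (run i τ a n) (τ n) (a n (dec (run i τ a n)))
  run-last i τ a zero    = refl
  run-last i τ a (suc n) = run-last _ (τ ∘ suc) (a ∘ suc) n

  answers : Sequence → Policy → Sequence
  answers τ a n = a n (dec (run initial τ a n))

  T≡run : ∀ τ a n → T τ (answers τ a) n ≡ run initial τ a n
  T≡run τ a zero    = refl
  T≡run τ a (suc n) = trans (cong (λ i → F i (τ n) (answers τ a n)) (T≡run τ a n)) (sym (run-last initial τ a n))

  run-splice-≤ : ∀ i k τ τ′ a a′ n → n ≤ k → run i (splice k τ τ′) (splice k a a′) n ≡ run i τ a n
  run-splice-≤ i k       τ τ′ a a′ zero    _         = refl
  run-splice-≤ i (suc k) τ τ′ a a′ (suc n) (s≤s n≤k) = run-splice-≤ _ k (τ ∘ suc) τ′ (a ∘ suc) a′ n n≤k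

  run-splice-+ : ∀ i k τ τ′ a a′ n → run i (splice k τ τ′) (splice k a a′) (k + n) ≡ run (run i τ a k) τ′ a′ n
  run-splice-+ i zero    τ τ′ a a′ n = refl
  run-splice-+ i (suc k) τ τ′ a a′ n = run-splice-+ _ k (τ ∘ suc) τ′ (a ∘ suc) a′ n

  converge : ∀ t τ a → (∀ n {v} → τ n ≡ just v → mem t (elt v) ≡ true) →
             (∀ x → mem t x ≡ true → ∃[ n ] τ n ≡ just (value x)) →
             (∀ n → Valid t (dec (run initial τ a n)) (answers τ a n)) →
             ∃[ N ] ∀ n → N ≤ n → dec (run initial τ a n) ≡ t
  converge t τ a sound complete ok =
    let N , conv = identifies (enc t) τ (answers τ a) (sound′ , complete′) check
    in N , λ n N≤n → trans (cong dec (sym (T≡run τ a n))) (trans (≈⇒dec≡ {T τ (answers τ a) n} {enc t} (conv n N≤n)) (dec-enc t))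
    where
    to : ∀ v → mem t (elt v) ≡ true → lang (enc t) v
    to v v∈ = cong b2n (trans (cong (λ s → mem s (elt v)) (dec-enc t)) v∈)
    from : ∀ v → lang (enc t) v → mem t (elt v) ≡ true
    from v v∈ = trans (cong (λ s → mem s (elt v)) (sym (dec-enc t))) (b2n-1 v∈)
    sound′ : ∀ {v} → SMPL τ v → lang (enc t) v
    sound′ {v} (n , τn) = to v (sound n τn)
    complete′ : ∀ {v} → lang (enc t) v → SMPL τ v
    complete′ {v} v∈ = let n , τn = complete (elt v) (from v v∈) in n , trans τn (cong just (value-elt v))
    valid⇒check : ∀ i n c → Valid t (dec i) c → CHECK (lang (enc t)) (lang i) τ n c
    valid⇒check i n nothing  ok {v} v∈ = to v (ok (elt v) (b2n-1 v∈))
    valid⇒check i n (just v) (v∈ , v∉) = cong b2n v∈ , λ v∈t → true≢false (trans (sym (from v v∈t)) v∉)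
    check : IsCexSequence CHECK E (lang (enc t)) τ (answers τ a)
    check n = valid⇒check (T τ (answers τ a) n) n (answers τ a n)
      (subst (λ i → Valid t (dec i) (answers τ a n)) (sym (T≡run τ a n)) (ok n))

  onS : Policy
  onS _ = answerS p

  -- The first visit is taken because the answers of `answerS` carry over to an `R t` only for
  -- hypotheses other than `S p`.
  first-hit : ∀ τ → (∀ n {v} → τ n ≡ just v → mem (S p) (elt v) ≡ true) → (∀ x → mem (S p) x ≡ true → ∃[ n ] τ n ≡ just (value x)) →
              ∃[ n ] dec (run initial τ onS n) ≡ S p × (∀ m → m < n → dec (run initial τ onS m) ≢ S p)
  first-hit τ sound complete =
    let N , conv = converge (S p) τ onS sound complete (λ n → answerS-valid p (dec (run initial τ onS n)))
    in first (λ n → dec (run initial τ onS n) ≟S p) N (conv N ≤-refl)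

  abstract
    hit₁ : ∃[ n ] dec (run initial (canon (S p)) onS n) ≡ S p × (∀ m → m < n → dec (run initial (canon (S p)) onS m) ≢ S p)
    hit₁ = first-hit (canon (S p)) (λ n eq → proj₂ (canon-sound (S p) n eq)) (λ x x∈ → value x , canon-complete (S p) x x∈)

  n₁ : ℕ
  n₁ = proj₁ hit₁

  i₁ : ℕ
  i₁ = run initial (canon (S p)) onS n₁

  abstract
    bound₁ : ∃[ M ] ∀ j → j < n₁ → ∀ {v} → answers (canon (S p)) onS j ≡ just v → v ≤ M
    bound₁ = bound (answers (canon (S p)) onS) n₁

  -- At least `n₁`, so that the first `n₁` canonical data belong to every candidate, and above the
  -- answers given meanwhile, so that no label is among them.
  base : ℕ
  base = n₁ + suc (proj₁ bound₁)

  module Candidate (B l : ℕ) (base≤B : base ≤ B) (B≤l : B ≤ l) (l-odd : odd l ≡ true) where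

    m : ℕ
    m = (2 + (B + l)) + (2 + (B + l))

    member : ℕ → Bool
    member e = ((suc e ≤ᵇ B) ∧ inS p e) ∨ (e ≡ᵇ l)

    t : ℕ
    t = mask member (suc l)

    width : ∀ {e} → member e ≡ true → e < suc l
    width {e} e∈ with ∨-true {(suc e ≤ᵇ B) ∧ inS p e} e∈
    ... | inj₁ s = m≤n⇒m≤1+n (≤-trans (≤ᵇ-true (suc e) B (proj₁ (∧-true {suc e ≤ᵇ B} s))) B≤l)
    ... | inj₂ eq rewrite ≡ᵇ-true e l eq = ≤-refl

    member⇒bit : ∀ {e} → member e ≡ true → bit e t ≡ true
    member⇒bit {e} e∈ = trans (bit-mask member (suc l) e (width e∈)) e∈

    S⇒bit : ∀ {e} → e < B → inS p e ≡ true → bit e t ≡ true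
    S⇒bit {e} e<B e∈ = member⇒bit (∨-introˡ _ (subst (λ c → c ∧ inS p e ≡ true) (sym (true-≤ᵇ e<B)) e∈))

    bit⇒ : ∀ e → bit e t ≡ true → e ≢ l → inS p e ≡ true
    bit⇒ e e∈ e≢l with ∨-true {(suc e ≤ᵇ B) ∧ inS p e} (bit-mask⇒ member (suc l) e e∈)
    ... | inj₁ s  = proj₂ (∧-true {suc e ≤ᵇ B} s)
    ... | inj₂ eq = ⊥-elim (e≢l (≡ᵇ-true e l eq))

    label∈t : bit l t ≡ true
    label∈t = member⇒bit (∨-introʳ ((suc l ≤ᵇ B) ∧ inS p l) (≡ᵇ-refl l))

    odd∉S : ∀ e → odd e ≡ true → inS p e ≢ true
    odd∉S e oe e∈ rewrite oe with () ← e∈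

    hole-even : ∀ q → odd (hole q) ≡ false
    hole-even false = refl
    hole-even true  = refl

    hole≢l : hole p ≢ l
    hole≢l eq = true≢false (trans (sym l-odd) (trans (cong odd (sym eq)) (hole-even p)))

    decoy : Decoy p t l
    decoy = record
      { label-odd = l-odd
      ; label∈    = label∈t
      ; only      = only
      ; hole∉     = ¬true λ h∈ → true≢false (trans (sym (bit⇒ (hole p) h∈ hole≢l)) (hole∉S p))
      }
      where
      only : ∀ e → odd e ≡ true → bit e t ≡ true → e ≡ l
      only e oe e∈ with e ≟ l
      ... | yes eq = eq
      ... | no e≢l = ⊥-elim (odd∉S e oe (bit⇒ e e∈ e≢l))

    l<m : l < m
    l<m = s≤s (≤-trans (m≤n+m l B) (≤-trans (n≤1+n _) (m≤m+n (suc (B + l)) (2 + (B + l)))))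

    m∉ : bit m t ≡ false
    m∉ = bit-mask-≥ member (suc l) m l<m

    onR : Policy
    onR _ = answerR p t m

    -- The engine's reaction to `R t` after a visit to `S p`. It is determined before `d` is chosen,
    -- which lets `d` exceed every `u` tested in it.
    tail : ℕ → St
    tail j = dec (run i₁ (canon (R t)) onR j)

    τ₁ : Sequence
    τ₁ = splice n₁ (canon (S p)) (canon (R t))

    a₁ : Policy
    a₁ = splice n₁ onS onR

    sound₁ : ∀ n {v} → τ₁ n ≡ just v → mem (R t) (elt v) ≡ true
    sound₁ n {v} eq with split n₁ n
    ... | after j refl = proj₂ (canon-sound (R t) j (trans (sym (splice-+ n₁ (canon (S p)) (canon (R t)) j)) eq))
    ... | before n<n₁ with refl , v∈ ← canon-sound (S p) n (trans (sym (splice-< n₁ (canon (S p)) (canon (R t)) n n<n₁)) eq) with elt n in en | v∈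
    ...   | ord e | e∈ = S⇒bit (≤-<-trans (value-ord≥ en) (<-≤-trans n<n₁ (≤-trans (m≤m+n n₁ _) base≤B))) e∈

    complete₁ : ∀ x → mem (R t) x ≡ true → ∃[ n ] τ₁ n ≡ just (value x)
    complete₁ x x∈ = n₁ + value x , trans (splice-+ n₁ (canon (S p)) (canon (R t)) (value x)) (canon-complete (R t) x x∈)

    state-after : ∀ j → dec (run initial τ₁ a₁ (n₁ + j)) ≡ tail j
    state-after j = cong dec (run-splice-+ initial n₁ (canon (S p)) (canon (R t)) onS onR j)

    valid₁ : ∀ n → Valid (R t) (dec (run initial τ₁ a₁ n)) (answers τ₁ a₁ n)
    valid₁ n with split n₁ n
    ... | after j refl rewrite splice-+ n₁ onS onR j =
          answerR-valid {t = t} decoy (even∈S p (B + l)) m∉ (λ _ e∈ → e∈) (dec (run initial τ₁ a₁ (n₁ + j))) (λ _ _ _ _ e∉ → e∉)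
    ... | before n<n₁ rewrite splice-< n₁ onS onR n n<n₁ | run-splice-≤ initial n₁ (canon (S p)) (canon (R t)) onS onR n (<⇒≤ n<n₁) =
          answerS-decoy decoy _ (proj₂ (proj₂ hit₁) n n<n₁) λ eq → <⇒≱ (≤-trans (m≤n+m _ n₁) base≤B)
            (≤-trans B≤l (≤-trans (m≤m*n l 6) (proj₂ bound₁ n n<n₁ eq)))

    abstract
      converged : ∃[ N ] ∀ n → N ≤ n → dec (run initial τ₁ a₁ n) ≡ R t
      converged = converge (R t) τ₁ a₁ sound₁ complete₁ valid₁

    tail-final : ∀ j → proj₁ converged ≤ j → tail j ≡ R t
    tail-final j N≤j = trans (sym (state-after j)) (proj₂ converged (n₁ + j) (≤-trans N≤j (m≤n+m j n₁)))

    masks : Sequence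
    masks j with tail j
    ... | R u = just u
    ... | _   = nothing

    abstract
      bound₂ : ∃[ M ] ∀ j → j < proj₁ converged → ∀ {v} → masks j ≡ just v → v ≤ M
      bound₂ = bound masks (proj₁ converged)

    fresh : ℕ
    fresh = proj₁ bound₂ ⊔ t

    tested≤fresh : ∀ j u → tail j ≡ R u → u ≤ fresh
    tested≤fresh j u eq with j <? proj₁ converged
    ... | yes j<N = ≤-trans (proj₂ bound₂ j j<N masks≡) (m≤m⊔n _ t)
      where
      masks≡ : masks j ≡ just u
      masks≡ rewrite eq = refl
    ... | no  j≮N with refl ← trans (sym eq) (tail-final j (≮⇒≥ j≮N)) = m≤n⊔m (proj₁ bound₂) t

    -- If some history hides d from the engine before its first visit to S p, then
    -- from there the engine behaves as on the target R t and never finds R t ∪ {d}.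
    module Confusion (d : ℕ) (d∈ : inS p d ≡ true) (m<d : m < d) (fresh≤d : fresh ≤ d)
      (τ : Sequence) (n₂ : ℕ) (hit : dec (run initial τ onS n₂) ≡ S p)
      (not-before : ∀ n → n < n₂ → dec (run initial τ onS n) ≢ S p)
      (data-ok : ∀ n → n < n₂ → ∀ {v} → τ n ≡ just v → ∃[ e ] v ≡ e * 6 × inS p e ≡ true × (e < B ⊎ e ≡ d))
      (d-seen : ∃[ n ] n < n₂ × τ n ≡ just (d * 6))
      (label-hidden : ∀ n → n < n₂ → answers τ onS n ≢ just (l * 6))
      where

      member′ : ℕ → Bool
      member′ e = bit e t ∨ (e ≡ᵇ d)

      t′ : ℕ
      t′ = mask member′ (suc d)

      l<d : l < d
      l<d = <-trans l<m m<d

      member′⇒bit : ∀ {e} → member′ e ≡ true → bit e t′ ≡ true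
      member′⇒bit {e} e∈ = trans (bit-mask member′ (suc d) e within) e∈
        where
        within : e < suc d
        within with ∨-true {bit e t} e∈
        ... | inj₁ et = <-trans (width (bit-mask⇒ member (suc l) e et)) (s≤s l<d)
        ... | inj₂ eq rewrite ≡ᵇ-true e d eq = ≤-refl

      t⊆t′ : ∀ e → bit e t ≡ true → bit e t′ ≡ true
      t⊆t′ e e∈ = member′⇒bit {e} (∨-introˡ _ e∈)

      d∈t′ : bit d t′ ≡ true
      d∈t′ = member′⇒bit {d} (∨-introʳ (bit d t) (≡ᵇ-refl d))

      outside : ∀ e → bit e t ≡ false → e ≢ d → bit e t′ ≡ false
      outside e e∉ e≢d = ¬true λ e∈ → contra (∨-true {bit e t} (bit-mask⇒ member′ (suc d) e e∈))
        where
        contra : bit e t ≡ true ⊎ (e ≡ᵇ d) ≡ true → ⊥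
        contra (inj₁ et) = true≢false (trans (sym et) e∉)
        contra (inj₂ eq) = e≢d (≡ᵇ-true e d eq)

      decoy′ : Decoy p t′ l
      decoy′ = record
        { label-odd = l-odd
        ; label∈    = t⊆t′ l label∈t
        ; only      = only
        ; hole∉     = outside (hole p) (Decoy.hole∉ decoy) λ { eq → true≢false (trans (sym (subst (λ e → inS p e ≡ true) (sym eq) d∈)) (hole∉S p)) }
        }
        where
        only : ∀ e → odd e ≡ true → bit e t′ ≡ true → e ≡ l
        only e oe e∈ with ∨-true {bit e t} (bit-mask⇒ member′ (suc d) e e∈)
        ... | inj₁ et = Decoy.only decoy e oe et
        ... | inj₂ eq with refl ← ≡ᵇ-true e d eq = ⊥-elim (odd∉S e oe d∈)

      τ₂ : Sequence
      τ₂ = splice n₂ τ (canon (R t))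

      a₂ : Policy
      a₂ = splice n₂ onS onR

      ord∈ : ∀ e → bit e t′ ≡ true → mem (R t′) (elt (e * 6)) ≡ true
      ord∈ e e∈ = trans (cong (mem (R t′)) (elt-value (ord e))) e∈

      R⊆R′ : ∀ x → mem (R t) x ≡ true → mem (R t′) x ≡ true
      R⊆R′ (ord e) e∈ = t⊆t′ e e∈
      R⊆R′ (zed _) _  = refl
      R⊆R′ (two a) a∈ = ⊥-elim (odd-bit⇒odds≢0 l t l-odd label∈t (≡ᵇ-true _ _ (proj₂ (∧-true {a ≡ᵇ 0} a∈))))

      R′⊆ : ∀ x → mem (R t′) x ≡ true → mem (R t) x ≡ true ⊎ x ≡ ord d
      R′⊆ (zed _) _  = inj₁ refl
      R′⊆ (two a) a∈ = ⊥-elim (odd-bit⇒odds≢0 l t′ l-odd (t⊆t′ l label∈t) (≡ᵇ-true _ _ (proj₂ (∧-true {a ≡ᵇ 0} a∈))))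
      R′⊆ (ord e) e∈ with ∨-true {bit e t} (bit-mask⇒ member′ (suc d) e e∈)
      ... | inj₁ et = inj₁ et
      ... | inj₂ eq = inj₂ (cong ord (≡ᵇ-true e d eq))

      sound₂ : ∀ n {v} → τ₂ n ≡ just v → mem (R t′) (elt v) ≡ true
      sound₂ n {v} eq with split n₂ n
      ... | after j refl = R⊆R′ (elt v) (proj₂ (canon-sound (R t) j (trans (sym (splice-+ n₂ τ (canon (R t)) j)) eq)))
      ... | before n<n₂ with data-ok n n<n₂ (trans (sym (splice-< n₂ τ (canon (R t)) n n<n₂)) eq)
      ...   | e , refl , e∈ , inj₁ e<B  = ord∈ e (t⊆t′ e (S⇒bit e<B e∈))
      ...   | e , refl , e∈ , inj₂ refl = ord∈ d d∈t′

      complete₂ : ∀ x → mem (R t′) x ≡ true → ∃[ n ] τ₂ n ≡ just (value x)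
      complete₂ x x∈ with R′⊆ x x∈
      ... | inj₁ x∈t  = n₂ + value x , trans (splice-+ n₂ τ (canon (R t)) (value x)) (canon-complete (R t) x x∈t)
      ... | inj₂ refl = let n , n<n₂ , τn = d-seen in n , trans (splice-< n₂ τ (canon (R t)) n n<n₂) τn

      -- Both histories end at `S p`, so `run-dec` makes the continuations agree although only this
      -- one has shown `d`.
      state-after′ : ∀ j → dec (run initial τ₂ a₂ (n₂ + j)) ≡ tail j
      state-after′ j = trans (cong dec (run-splice-+ initial n₂ τ (canon (R t)) onS onR j))
        (run-dec (canon (R t)) onR j (trans hit (sym (proj₁ (proj₂ hit₁)))))

      m∉′ : bit m t′ ≡ false
      m∉′ = outside m m∉ (<⇒≢ m<d)

      -- A bit of `u` is less than `u`, and `d` is at least every `u` tested, so the error reported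
      -- against `R u` is never `d`.
      unnoticed : ∀ j u → dec (run initial τ₂ a₂ (n₂ + j)) ≡ R u → ∀ e → bit e u ≡ true → bit e t ≡ false → bit e t′ ≡ false
      unnoticed j u eq e e∈ e∉ = outside e e∉ λ { refl →
        true≢false (trans (sym e∈) (bit-large (≤-trans (tested≤fresh j u (trans (sym (state-after′ j)) eq)) fresh≤d))) }

      valid₂ : ∀ n → Valid (R t′) (dec (run initial τ₂ a₂ n)) (answers τ₂ a₂ n)
      valid₂ n with split n₂ n
      ... | after j refl rewrite splice-+ n₂ onS onR j =
            answerR-valid {t = t} decoy′ (even∈S p (B + l)) m∉′ t⊆t′ (dec (run initial τ₂ a₂ (n₂ + j))) (unnoticed j)
      ... | before n<n₂ rewrite splice-< n₂ onS onR n n<n₂ | run-splice-≤ initial n₂ τ (canon (R t)) onS onR n (<⇒≤ n<n₂) =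
            answerS-decoy decoy′ _ (not-before n n<n₂) (label-hidden n n<n₂)

      contradiction : ⊥
      contradiction =
        let N₂ , conv₂ = converge (R t′) τ₂ a₂ sound₂ complete₂ valid₂
            N₁ = proj₁ converged
            eq : R t ≡ R t′
            eq = trans (sym (tail-final (N₁ + N₂) (m≤m+n N₁ N₂)))
                   (trans (sym (state-after′ (N₁ + N₂))) (conv₂ (n₂ + (N₁ + N₂)) (≤-trans (m≤n+m N₂ N₁) (m≤n+m _ n₂))))
        in true≢false (trans (sym (trans (cong (λ s → mem s (ord d)) eq) d∈t′))
             (bit-mask-≥ member (suc l) d l<d))

  -- Two labels over the same `B`: the answer following the bait may be one of them, but not both.
  module Small (x : ℕ) = Candidate (base + x) (suc ((base + x) + (base + x))) (m≤m+n base x)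
    (m≤n⇒m≤1+n (m≤m+n (base + x) (base + x))) (proj₂ (half-suc-double (base + x)))
  module Large (x : ℕ) = Candidate (base + x) (suc (suc (base + x) + suc (base + x))) (m≤m+n base x)
    (m≤n⇒m≤1+n (m≤n⇒m≤1+n (m≤m+n (base + x) (suc (base + x))))) (proj₂ (half-suc-double (suc (base + x))))

  abstract
    ceiling : ℕ → ℕ
    ceiling x = (Small.fresh x + Large.fresh x) + (Small.m x + Large.m x)

    small-ceiling : ∀ x → Small.fresh x ≤ ceiling x × Small.m x ≤ ceiling x
    small-ceiling x =
      ≤-trans (m≤m+n (Small.fresh x) (Large.fresh x)) (m≤m+n _ (Small.m x + Large.m x)) ,
      ≤-trans (m≤m+n (Small.m x) (Large.m x)) (m≤n+m _ (Small.fresh x + Large.fresh x))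

    large-ceiling : ∀ x → Large.fresh x ≤ ceiling x × Large.m x ≤ ceiling x
    large-ceiling x =
      ≤-trans (m≤n+m (Large.fresh x) (Small.fresh x)) (m≤m+n _ (Small.m x + Large.m x)) ,
      ≤-trans (m≤n+m (Large.m x) (Small.m x)) (m≤n+m _ (Small.fresh x + Large.fresh x))

  bait : ℕ → ℕ
  bait x = (2 + ceiling x) + (2 + ceiling x)

  ceiling<bait : ∀ x → ceiling x < bait x
  ceiling<bait x = s≤s (≤-trans (n≤1+n _) (m≤m+n (suc (ceiling x)) (2 + ceiling x)))

  -- Odd times enumerate `S p` and even times show a bait, so every later moment has a bait at most
  -- two steps before it.
  feed : ℕ → ℕ → Maybe ℕ
  feed n x = if odd n then canon (S p) (half n) else just (bait x * 6)

  -- The engine's hypothesis, and a bound on all data and all answers so far.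
  conf : ℕ → ℕ × ℕ
  conf zero    = initial , encode (answerS p (dec initial))
  conf (suc n) = let i , x = conf n ; i′ = F i (feed n x) (answerS p (dec i))
                 in i′ , suc (x + (encode (feed n x) + encode (answerS p (dec i′))))

  limit : ℕ → ℕ
  limit n = proj₂ (conf n)

  τ : Sequence
  τ n = feed n (limit n)

  run≡conf : ∀ n → run initial τ onS n ≡ proj₁ (conf n)
  run≡conf zero    = refl
  run≡conf (suc n) = trans (run-last initial τ onS n) (cong (λ i → F i (τ n) (answerS p (dec i))) (run≡conf n))

  limit-suc : ∀ n → limit n < limit (suc n)
  limit-suc n = s≤s (m≤m+n (limit n) _)

  limit-mono : ∀ {m n} → m ≤ n → limit m ≤ limit n
  limit-mono {m} {zero}  z≤n = ≤-refl
  limit-mono {m} {suc n} m≤n with m≤n⇒m<n∨m≡n m≤n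
  ... | inj₁ (s≤s m≤n′) = ≤-trans (limit-mono m≤n′) (<⇒≤ (limit-suc n))
  ... | inj₂ refl        = ≤-refl

  n≤limit : ∀ n → n ≤ limit n
  n≤limit zero    = z≤n
  n≤limit (suc n) = ≤-<-trans (n≤limit n) (limit-suc n)

  feed≤limit : ∀ n → encode (τ n) ≤ limit (suc n)
  feed≤limit n = m≤n⇒m≤1+n (≤-trans (m≤m+n _ _) (m≤n+m _ (limit n)))

  answer≤limit : ∀ n → encode (answers τ onS n) ≤ limit n
  answer≤limit zero    = ≤-refl
  answer≤limit (suc n) rewrite run≡conf (suc n) = m≤n⇒m≤1+n (≤-trans (m≤n+m _ (encode (τ n))) (m≤n+m _ (limit n)))

  τ-form : ∀ n {v} → τ n ≡ just v → ∃[ e ] v ≡ e * 6 × inS p e ≡ true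
  τ-form n eq with odd n
  τ-form n refl | false = bait (limit n) , refl , even∈S p (ceiling (limit n))
  τ-form n {v} eq | true with refl , v∈ ← canon-sound (S p) (half n) eq with elt (half n) in en | v∈
  ... | ord e | e∈ = e , elt⇒value en , e∈

  τ-sound : ∀ n {v} → τ n ≡ just v → mem (S p) (elt v) ≡ true
  τ-sound n eq with e , refl , e∈ ← τ-form n eq = trans (cong (mem (S p)) (elt-value (ord e))) e∈

  τ-complete : ∀ x → mem (S p) x ≡ true → ∃[ n ] τ n ≡ just (value x)
  τ-complete x x∈ = suc (value x + value x) , enumerated
    where
    enumerated : τ (suc (value x + value x)) ≡ just (value x)
    enumerated rewrite proj₂ (half-double (value x)) | proj₁ (half-double (value x)) | +-identityʳ (value x) = canon-complete (S p) x x∈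

  abstract
    hit₂ : ∃[ n ] dec (run initial τ onS n) ≡ S p × (∀ m → m < n → dec (run initial τ onS m) ≢ S p)
    hit₂ = first-hit τ τ-sound τ-complete

  small-datum : ∀ {n k v e} → n < k → τ n ≡ just v → v ≡ e * 6 → e < base + limit k
  small-datum {n} {k} {v} {e} n<k eq refl = ≤-trans (s≤s (m≤m*n e 6)) (≤-trans (subst (λ y → encode y ≤ limit (suc n)) eq (feed≤limit n))
    (≤-trans (limit-mono n<k) (m≤n+m (limit k) base)))

  module _ (k : ℕ) (k-even : odd k ≡ false) where

    τ-bait : τ k ≡ just (bait (limit k) * 6)
    τ-bait rewrite k-even = refl

    τ-next : ∀ {v} → τ (suc k) ≡ just v → v ≤ k
    τ-next {v} eq = subst (_≤ k) (proj₁ (canon-sound (S p) (half (suc k))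
      (subst (λ b → (if not b then canon (S p) (half (suc k)) else just (bait (limit (suc k)) * 6)) ≡ just v) k-even eq))) (half≤ k)

    data-ok : ∀ n → n < 2 + k → ∀ {v} → τ n ≡ just v →
              ∃[ e ] v ≡ e * 6 × inS p e ≡ true × (e < base + limit k ⊎ e ≡ bait (limit k))
    data-ok n n<2+k {v} eq with e , v≡ , e∈ ← τ-form n eq | <-cmp n k
    ... | tri< n<k _ _  = e , v≡ , e∈ , inj₁ (small-datum n<k eq v≡)
    ... | tri≈ _ refl _ = e , v≡ , e∈ , inj₂ (*-cancelʳ-≡ e _ 6 (trans (sym v≡) (just-injective (trans (sym eq) τ-bait))))
    -- The one datum after the bait comes from the enumeration, which at time `suc k` has not gone
    -- beyond `k`.
    ... | tri> _ _ k<n with refl ← ≤-antisym (s≤s⁻¹ n<2+k) k<n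
      = e , v≡ , e∈ , inj₁ (≤-<-trans (subst (e ≤_) (sym v≡) (m≤m*n e 6)) (≤-<-trans (τ-next eq)
          (≤-trans (s≤s (n≤limit k)) (+-monoˡ-≤ (limit k) (≤-trans (s≤s z≤n) (m≤n+m (suc (proj₁ bound₁)) n₁))))))

    hidden : ∀ n l → n ≤ k → base + limit k ≤ l → answers τ onS n ≢ just (l * 6)
    hidden n l n≤k B≤l eq = <⇒≱ (≤-trans (s≤s (m≤m*n l 6)) (subst (λ y → encode y ≤ limit n) eq (answer≤limit n)))
      (≤-trans (limit-mono n≤k) (≤-trans (m≤n+m (limit k) base) B≤l))

    until : ∀ n₂ → n₂ ≤ 2 + k → ∀ l → base + limit k ≤ l →
            (suc k < n₂ → answers τ onS (suc k) ≢ just (l * 6)) → ∀ n → n < n₂ → answers τ onS n ≢ just (l * 6)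
    until n₂ n₂≤ l B≤l last n n<n₂ with n ≤? k
    ... | yes n≤k = hidden n l n≤k B≤l
    ... | no  n≰k with refl ← ≤-antisym (s≤s⁻¹ (≤-trans n<n₂ n₂≤)) (≰⇒> n≰k) = last n<n₂

    confused : ∀ n₂ → k < n₂ → n₂ ≤ 2 + k → dec (run initial τ onS n₂) ≡ S p →
               (∀ n → n < n₂ → dec (run initial τ onS n) ≢ S p) → ⊥
    -- The answer at `suc k` is the only relevant one that `limit k` does not bound; it selects the
    -- label.
    confused n₂ k<n₂ n₂≤ hit not-before with ≡-dec _≟_ (answers τ onS (suc k)) (just (suc ((base + x) + (base + x)) * 6))
      where
      x : ℕ
      x = limit k
    ... | no  ≢small = Small.Confusion.contradiction x (bait x) (even∈S p (ceiling x))
            (≤-<-trans (proj₂ (small-ceiling x)) (ceiling<bait x)) (≤-trans (proj₁ (small-ceiling x)) (<⇒≤ (ceiling<bait x)))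
            τ n₂ hit not-before (λ n n<n₂ → data-ok n (≤-trans n<n₂ n₂≤)) (k , k<n₂ , τ-bait)
            (until n₂ n₂≤ _ (m≤n⇒m≤1+n (m≤m+n (base + x) (base + x))) (λ _ → ≢small))
      where
      x : ℕ
      x = limit k
    ... | yes ≡small = Large.Confusion.contradiction x (bait x) (even∈S p (ceiling x))
            (≤-<-trans (proj₂ (large-ceiling x)) (ceiling<bait x)) (≤-trans (proj₁ (large-ceiling x)) (<⇒≤ (ceiling<bait x)))
            τ n₂ hit not-before (λ n n<n₂ → data-ok n (≤-trans n<n₂ n₂≤)) (k , k<n₂ , τ-bait)
            (until n₂ n₂≤ _ (m≤n⇒m≤1+n (m≤n⇒m≤1+n (m≤m+n (base + x) (suc (base + x)))))
              (λ _ ≡large → <⇒≢ (small<large (base + x)) (*-cancelʳ-≡ _ _ 6 (just-injective (trans (sym ≡small) ≡large)))))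
      where
      x : ℕ
      x = limit k
      small<large : ∀ B → suc (B + B) < suc (suc B + suc B)
      small<large B = s≤s (s≤s (+-monoʳ-≤ B (n≤1+n B)))

  ¬cegis : ⊥
  ¬cegis with hit₂
  ... | zero  , hit , _ = proj₂ other-limit hit
  ... | suc n , hit , not-before with odd n in n-odd
  ...   | false = confused n n-odd (suc n) ≤-refl (n≤1+n _) hit not-before
  ...   | true with n
  ...     | suc k = confused k (not-true (odd k) n-odd) (2 + k) (n≤1+n _) ≤-refl hit not-before
    where
    not-true : ∀ b → not b ≡ true → b ≡ false
    not-true false _ = refl

HCEGIS⊈CEGIS : HCEGIS ⊈ CEGIS
HCEGIS⊈CEGIS ⊆ = let E , identifies = ⊆ hcegis in Adversary.¬cegis E identifies

theorem2 : HCEGIS ⊈ CEGIS × CEGIS ⊈ HCEGIS × ¬ (HCEGIS ≐ CEGIS)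
theorem2 = HCEGIS⊈CEGIS , CEGIS⊈HCEGIS , λ HCEGIS≐CEGIS → HCEGIS⊈CEGIS (proj₁ HCEGIS≐CEGIS)
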